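{- Let $k\geq 4$ be an integer and let $\mathbf{x}=\mathbf{x}_k$ be the binary sequence defined in the context. Let $\mathcal{C}(n)$ denote the number of distinct factors of $\mathbf{x}$ of length $n$. Then there exists $N_0$ such that for all $N\geq N_0$, $$\Delta\mathcal{C}(N):=\mathcal{C}(N+1)-\mathcal{C}(N)\in\{4k-2,\,4k\}.$$
   Context: Fix an integer $k\geq 4$. Let $\mathcal{A}=\{0,1,\ldots,k-1,0',1',\ldots,(k-1)'\}$ (an alphabet of $2k$ letters). Let $\xi=\xi_k:\mathcal{A}^*\to\mathcal{A}^*$ be the morphism given by $\xi(0)=01$, $\xi(j)=j+1$ for $1\leq j\leq k-2$, $\xi(k-1)=0'$, and $\xi(0')=0'1'$, $\xi(j')=(j+1)'$ for $1\leq j\leq k-2$, $\xi((k-1)')=0$. Let $\mathbf{u}=\xi^\omega(0)$ be the infinite fixed point of $\xi$ starting with $0$. Let $\pi:\mathcal{A}^*\to\{0,1\}^*$ be the letter-to-letter morphism with $\pi(0)=0$, $\pi(j')=0$ for $1\leq j\leq k-1$, $\pi(0')=1$, $\pi(j)=1$ for $1\leq j\leq k-1$. Put $\mathbf{x}=\mathbf{x}_k=\pi(\mathbf{u})$. -}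

module Defs where

open import Data.Nat using (ℕ; zero; suc; _+_; _<?_)
open import Data.Fin using (Fin; zero; suc; toℕ; fromℕ<)
open import Data.Bool using (Bool; true; false; not)
open import Data.Product using (_×_; _,_; Σ; ∃-syntax)
open import Data.List using (List; []; _∷_; [_]; concatMap; map; upTo; length)
open import Data.List.Relation.Unary.All using (All)
open import Data.List.Relation.Unary.Unique.Propositional using (Unique)
open import Data.List.Membership.Propositional using (_∈_)
open import Relation.Nullary using (yes; no)
open import Relation.Binary.PropositionalEquality using (_≡_)

-- Alphabet 𝒜 = {0,…,k-1,0',…,(k-1)'}: the letter j is (j , false),
-- the primed letter j' is (j , true).
Letter : ℕ → Set
Letter k = Fin k × Bool

next : ∀ {k} → Letter k → Letter k
next {suc k} (j , p) with suc (toℕ j) <? suc k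
... | yes lt = fromℕ< lt , p
... | no _   = zero , not p

ξ : ∀ {k} → Letter k → List (Letter k)
ξ (zero , p)  = (zero , p) ∷ [ next (zero , p) ]
ξ (suc j , p) = [ next (suc j , p) ]

ξ* : ∀ {k} → List (Letter k) → List (Letter k)
ξ* = concatMap ξ

ξ^_[0] : ∀ {k} → ℕ → List (Letter (suc k))
ξ^ zero [0]  = [ (zero , false) ]
ξ^ suc n [0] = ξ* (ξ^ n [0])

-- π : letter-to-letter projection to {0,1} (false = 0, true = 1):
-- π(0) = 0, π(j') = 0 (j ≥ 1), π(0') = 1, π(j) = 1 (j ≥ 1).
π : ∀ {k} → Letter k → Bool
π (zero , p)  = p
π (suc j , p) = not p

nth : ∀ {A : Set} → A → List A → ℕ → A
nth d []       _       = d
nth d (a ∷ as) zero    = a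
nth d (a ∷ as) (suc i) = nth d as i

-- u = ξ^ω(0): since every ξ^n(0) starts with 0 and is a prefix of ξ^{n+1}(0),
-- with |ξ^n(0)| ≥ n+1, the i-th letter of u is the i-th letter of ξ^{i+1}(0).
-- 𝐱_k = π(u), as a function ℕ → Bool.  (k = 0 is a degenerate dummy case.)
𝐱 : ℕ → ℕ → Bool
𝐱 zero    i = false
𝐱 (suc k) i = π (nth (zero , false) (ξ^_[0] {k} (suc i)) i)

window : (ℕ → Bool) → ℕ → ℕ → List Bool
window x i n = map (λ j → x (i + j)) (upTo n)

IsFactor : (ℕ → Bool) → List Bool → Set
IsFactor x w = ∃[ i ] (window x i (length w) ≡ w)

Complexity : (ℕ → Bool) → ℕ → ℕ → Set
Complexity x n c =
  Σ (List (List Bool)) λ ws →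
    (length ws ≡ c) × Unique ws ×
    All (λ w → (length w ≡ n) × IsFactor x w) ws ×
    (∀ w → length w ≡ n → IsFactor x w → w ∈ ws)

{-# OPTIONS --safe #-}

-- Put q = k - 1 and X n = π(ξⁿ(0)), so that X (n+1) = X n · ¬X (n-q) and 𝐱 is the limit of the X n. Since 𝐱 is
-- binary and every factor extends to the left, C(N+1) - C(N) counts the left special factors of length N.
-- Reading 𝐱 from any position, one first completes a block a ā^i with 1 ≤ i ≤ k, and then meets a boundary of
-- some sign σ and level m ≥ 1: it is preceded by ¬σ X (m+q) and followed by σ X m and ± X (m+1). The pair (σ , m)
-- determines the block before the boundary. Hence a long left special word is c^r z with r ≤ q, where z follows
-- boundaries of two levels m < n of the same sign σ. Comparing what follows them, z is a prefix of σ𝐱, or else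
-- n = m + 1, c^r is the common suffix of the two blocks and z is a prefix of σ X (m+1) X (m-2q) longer than X (m+1).
-- The first kind gives 2 (2q + 1) = 4k - 2 words of each large length. The second gives two words for each
-- suitable m, and the intervals of lengths belonging to different m are disjoint.

module Submission where

open import Defs
open import Data.Bool using (Bool; true; false; not; _xor_) renaming (_≟_ to _≟ᵇ_)
open import Data.Bool.Properties using (not-involutive; not-¬; ¬-not; not-distribˡ-xor; not-distribʳ-xor; xor-assoc; xor-same; xor-identityʳ)
open import Data.Empty using (⊥; ⊥-elim)
open import Data.Fin using (Fin; zero; suc; toℕ; fromℕ<)
open import Data.Fin.Properties using (toℕ<n; toℕ-injective; toℕ-fromℕ<)
open import Data.List
open import Data.List.Membership.Propositional using (_∈_)
open import Data.List.Membership.Propositional.Properties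
open import Data.List.Properties
open import Data.List.Relation.Unary.All using (All)
import Data.List.Relation.Unary.All as All
import Data.List.Relation.Unary.All.Properties as All
import Data.List.Relation.Unary.AllPairs as AllPairs
open import Data.List.Relation.Unary.Any using (here; there; any?)
open import Data.List.Relation.Unary.Unique.Propositional using (Unique)
import Data.List.Relation.Unary.Unique.Propositional.Properties as Unique
open import Data.List.Relation.Unary.Unique.DecPropositional.Properties using (deduplicate-!)
open import Data.Maybe using (Maybe; just; nothing)
open import Data.Maybe.Properties using (just-injective)
open import Data.Nat
open import Data.Nat.Induction using (<-rec)
open import Data.Nat.Properties
open import Data.Product using (_×_; _,_; proj₁; proj₂; ∃-syntax)
open import Data.Sum using (_⊎_; inj₁; inj₂) renaming (map to map-⊎)
open import Relation.Binary.Definitions using (tri<; tri≈; tri>)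
open import Relation.Binary.PropositionalEquality
open import Relation.Nullary
open import Relation.Nullary.Decidable using (_×-dec_)

-- What makes futures comparable is a single letter: inside any longer `X n`, the prefix `X m` is
-- followed by `true`, while every `X` begins with `false`. Agreement beyond all of `X n` (with m <
-- n) needs n = m + 1 and comes from the identity X m · ¬X (m+1) = X m · ¬X (m-q) · X (m-2q) ⋯ = X
-- (m+1) · X (m-2q) ⋯, in which the boundary of level m imitates the next level for a while. The
-- bound r ≤ q holds because a run of k letters fills both blocks, and both then have the same
-- letter in front of it. The factor 2q + 1 counts the empty run and, for each r from 1 to q, the
-- two letters that can be repeated. Since `Complexity` asks for an explicit list, all factors of a
-- given length must also be found in one `X` of computable index, and each factor must be given one
-- left extension by a decidable rule.

private variable
  A : Set

-- Prefixes, suffixes and infixes of lists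

infix 4 _≼_

_≼_ : List A → List A → Set
u ≼ v = ∃[ t ] (u ++ t ≡ v)

Suffix : List A → List A → Set
Suffix u v = ∃[ t ] (t ++ u ≡ v)

Infix : List A → List A → Set
Infix u v = ∃[ a ] ∃[ b ] (a ++ u ++ b ≡ v)

≼-refl : {u : List A} → u ≼ u
≼-refl {u = u} = [] , ++-identityʳ u

≼-trans : {u v w : List A} → u ≼ v → v ≼ w → u ≼ w
≼-trans {u = u} (s , refl) (t , refl) = s ++ t , sym (++-assoc u s t)

≼-++ : (u : List A) {v : List A} → u ≼ u ++ v
≼-++ u {v} = v , refl

≼-++ˡ : (u : List A) {v w : List A} → v ≼ w → u ++ v ≼ u ++ w
≼-++ˡ u {v} (t , refl) = t , ++-assoc u v t

≼⇒Infix : {u v : List A} → u ≼ v → Infix u v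
≼⇒Infix (t , e) = [] , t , e

Suffix⇒Infix : {u v : List A} → Suffix u v → Infix u v
Suffix⇒Infix {u = u} (t , e) = t , [] , trans (cong (t ++_) (++-identityʳ u)) e

Infix-trans : {u v w : List A} → Infix u v → Infix v w → Infix u w
Infix-trans {u = u} (a , b , refl) (c , d , refl) = c ++ a , b ++ d , eq
  where
  open ≡-Reasoning
  eq : (c ++ a) ++ u ++ b ++ d ≡ c ++ (a ++ u ++ b) ++ d
  eq = begin
    (c ++ a) ++ u ++ b ++ d    ≡⟨ ++-assoc c a _ ⟩
    c ++ a ++ u ++ b ++ d      ≡⟨ cong (λ v → c ++ a ++ v) (++-assoc u b d) ⟨
    c ++ a ++ (u ++ b) ++ d    ≡⟨ cong (c ++_) (++-assoc a (u ++ b) d) ⟨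
    c ++ (a ++ u ++ b) ++ d    ∎

Infix-map : {B : Set} (f : A → B) {u v : List A} → Infix u v → Infix (map f u) (map f v)
Infix-map f {u} (a , b , refl) = map f a , map f b ,
  sym (trans (map-++ f a (u ++ b)) (cong (map f a ++_) (map-++ f u b)))

Suffix-++ˡ : (w : List A) {u v : List A} → Suffix u v → Suffix u (w ++ v)
Suffix-++ˡ w {u} (t , refl) = w ++ t , ++-assoc w t u

Suffix-++ʳ : {u v : List A} (w : List A) → Suffix u v → Suffix (u ++ w) (v ++ w)
Suffix-++ʳ {u = u} w (t , refl) = t , sym (++-assoc t u w)

Suffix-trans : {u v w : List A} → Suffix u v → Suffix v w → Suffix u w
Suffix-trans {u = u} (s , refl) (t , refl) = t ++ s , ++-assoc t s u

≼-length : {u v : List A} → u ≼ v → length u ≤ length v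
≼-length {u = u} (t , refl) = subst (length u ≤_) (sym (length-++ u)) (m≤m+n _ _)

≼-linear : (u v : List A) {s t : List A} → u ++ s ≡ v ++ t → length u ≤ length v → u ≼ v
≼-linear [] v e l = v , refl
≼-linear (x ∷ u) (y ∷ v) e (s≤s l) with ∷-injective e
... | refl , e′ with ≼-linear u v e′ l
... | r , refl = r , refl

≼-common : {u v w : List A} → u ≼ w → v ≼ w → length u ≤ length v → u ≼ v
≼-common {u = u} {v} (s , e) (t , e′) l = ≼-linear u v (trans e (sym e′)) l

++-injective : (u v : List A) {s t : List A} → u ++ s ≡ v ++ t → length u ≡ length v → u ≡ v × s ≡ t
++-injective [] [] e l = refl , e
++-injective (x ∷ u) (y ∷ v) e l with ∷-injective e
... | refl , e′ with ++-injective u v e′ (suc-injective l)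
... | refl , e″ = refl , e″

++-split : (a b c d : List A) → a ++ b ≡ c ++ d →
  (∃[ e ] (a ≡ c ++ e × d ≡ e ++ b)) ⊎ (∃[ e ] (c ≡ a ++ e × b ≡ e ++ d))
++-split a b [] d e = inj₁ (a , refl , sym e)
++-split [] b (x ∷ c) d e = inj₂ (x ∷ c , refl , e)
++-split (y ∷ a) b (x ∷ c) d e with ∷-injective e
... | refl , e′ with ++-split a b c d e′
... | inj₁ (f , refl , q) = inj₁ (f , refl , q)
... | inj₂ (f , refl , q) = inj₂ (f , refl , q)

mismatch : (w p : List A) {x y : A} {t t′ s s′ : List A} → x ≢ y →
  w ++ t ≡ p ++ x ∷ s → w ++ t′ ≡ p ++ y ∷ s′ → w ≼ p
mismatch [] p n e e′ = p , refl
mismatch (z ∷ w) [] n e e′ = ⊥-elim (n (trans (sym (proj₁ (∷-injective e))) (proj₁ (∷-injective e′))))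
mismatch (z ∷ w) (y ∷ p) n e e′ with ∷-injective e
... | refl , e₁ with mismatch w p n e₁ (proj₂ (∷-injective e′))
... | r , refl = r , refl

≼-take : {u v : List A} → u ≼ v → u ≡ take (length u) v
≼-take {u = []} _ = refl
≼-take {u = x ∷ u} (t , refl) = cong (x ∷_) (≼-take (t , refl))

take-≼ : (n : ℕ) (v : List A) → take n v ≼ v
take-≼ n v = drop n v , take++drop≡id n v

length-take-≤ : (n : ℕ) (v : List A) → n ≤ length v → length (take n v) ≡ n
length-take-≤ n v l = trans (length-take n v) (m≤n⇒m⊓n≡m l)

-- Signs acting on binary words

infixr 6 _⊙_

_⊙_ : Bool → List Bool → List Bool
s ⊙ w = map (s xor_) w

⊙-++ : ∀ s u v → s ⊙ (u ++ v) ≡ s ⊙ u ++ s ⊙ v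
⊙-++ s = map-++ (s xor_)

false-⊙ : ∀ w → false ⊙ w ≡ w
false-⊙ = map-id

⊙-⊙ : ∀ s t w → s ⊙ t ⊙ w ≡ (s xor t) ⊙ w
⊙-⊙ s t w = trans (sym (map-∘ w)) (map-cong (λ b → sym (xor-assoc s t b)) w)

⊙-involutive : ∀ s w → s ⊙ s ⊙ w ≡ w
⊙-involutive s w = trans (⊙-⊙ s s w) (trans (cong (_⊙ w) (xor-same s)) (false-⊙ w))

length-⊙ : ∀ s w → length (s ⊙ w) ≡ length w
length-⊙ s = length-map (s xor_)

⊙-≼ : ∀ s {u v} → u ≼ v → s ⊙ u ≼ s ⊙ v
⊙-≼ s {u} (t , refl) = s ⊙ t , sym (⊙-++ s u t)

⊙-Suffix : ∀ s {u v} → Suffix u v → Suffix (s ⊙ u) (s ⊙ v)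
⊙-Suffix s {u} (t , refl) = s ⊙ t , sym (⊙-++ s t u)

⊙-injective : ∀ s {u v} → s ⊙ u ≡ s ⊙ v → u ≡ v
⊙-injective s {u} {v} e = trans (sym (⊙-involutive s u)) (trans (cong (s ⊙_) e) (⊙-involutive s v))

⊙-replicate : ∀ s n b → s ⊙ replicate n b ≡ replicate n (s xor b)
⊙-replicate s n b = map-replicate (s xor_) n b

-- The words `X n`, known only through their recursion

module Words (q : ℕ) (1≤q : 1 ≤ q) (X : ℕ → List Bool)
  (X-zero : X 0 ≡ false ∷ [])
  (X-suc : ∀ n → X (suc n) ≡ X n ++ true ⊙ X (n ∸ q)) where

  X-≼-suc : ∀ n → X n ≼ X (suc n)
  X-≼-suc n = _ , sym (X-suc n)

  X-mono : ∀ {m n} → m ≤ n → X m ≼ X n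
  X-mono {m} m≤n = go (≤⇒≤′ m≤n)
    where
    go : ∀ {n} → m ≤′ n → X m ≼ X n
    go ≤′-refl = ≼-refl
    go (≤′-step l) = ≼-trans (go l) (X-≼-suc _)

  X-head : ∀ n → ∃[ s ] (X n ≡ false ∷ s)
  X-head n with X-mono {0} {n} z≤n
  ... | s , e = s , trans (sym e) (cong (_++ s) X-zero)

  X-suc-true : ∀ n → ∃[ s ] (X (suc n) ≡ X n ++ true ∷ s)
  X-suc-true n with X-head (n ∸ q)
  ... | s , e = true ⊙ s , trans (X-suc n) (cong (λ v → X n ++ true ⊙ v) e)

  X-<-true : ∀ {m n} → m < n → ∃[ s ] (X n ≡ X m ++ true ∷ s)
  X-<-true {m} m<n with X-suc-true m | X-mono m<n
  ... | s , e | t , e′ = s ++ t , trans (sym e′) (trans (cong (_++ t) e) (++-assoc (X m) _ t))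

  length-X-suc : ∀ n → length (X (suc n)) ≡ length (X n) + length (X (n ∸ q))
  length-X-suc n = trans (cong length (X-suc n)) (trans (length-++ (X n))
    (cong (length (X n) +_) (length-⊙ true (X (n ∸ q)))))

  length-X-pos : ∀ n → 1 ≤ length (X n)
  length-X-pos n with X-head n
  ... | s , e = subst (λ v → 1 ≤ length v) (sym e) (s≤s z≤n)

  length-X : ∀ n → n < length (X n)
  length-X zero = ≤-reflexive (sym (cong length X-zero))
  length-X (suc n) = begin
    2 + n                              ≡⟨ +-comm 1 (suc n) ⟩
    suc n + 1                          ≤⟨ +-mono-≤ (length-X n) (length-X-pos (n ∸ q)) ⟩
    length (X n) + length (X (n ∸ q))  ≡⟨ length-X-suc n ⟨
    length (X (suc n))                 ∎
    where open ≤-Reasoning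

  length-X-mono : ∀ {m n} → m ≤ n → length (X m) ≤ length (X n)
  length-X-mono m≤n = ≼-length (X-mono m≤n)

  X-small : ∀ n → n ≤ suc q → X n ≡ false ∷ replicate n true
  X-small zero _ = X-zero
  X-small (suc n) (s≤s n≤q) = begin
    X (suc n)                                  ≡⟨ X-suc n ⟩
    X n ++ true ⊙ X (n ∸ q)                    ≡⟨ cong₂ (λ u m → u ++ true ⊙ X m) (X-small n (m≤n⇒m≤1+n n≤q)) (m≤n⇒m∸n≡0 n≤q) ⟩
    false ∷ replicate n true ++ true ⊙ X 0     ≡⟨ cong (λ u → false ∷ replicate n true ++ true ⊙ u) X-zero ⟩
    false ∷ replicate n true ++ true ∷ []      ≡⟨ cong (false ∷_) (replicate-snoc n) ⟩
    false ∷ replicate (suc n) true             ∎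
    where
    open ≡-Reasoning
    replicate-snoc : ∀ n → replicate n true ++ true ∷ [] ≡ true ∷ replicate n true
    replicate-snoc zero = refl
    replicate-snoc (suc n) = cong (true ∷_) (replicate-snoc n)

  m∸n<m : ∀ {m n} → 1 ≤ m → 1 ≤ n → m ∸ n < m
  m∸n<m {suc m} {suc n} _ _ = s≤s (m∸n≤m m n)

  -- The bracket is `X (suc (m ∸ q))`, a proper prefix of `X (suc m)` because m and q are positive.
  -- Negated and placed after `X m`, its first part completes `X m` to `X (suc m)`.
  X-peel : ∀ m → 1 ≤ m → ∃[ s ] (X (suc m) ≡ (X (m ∸ q) ++ true ⊙ X (m ∸ q ∸ q)) ++ true ∷ s)
  X-peel m 1≤m with X-<-true {suc (m ∸ q)} {suc m} (s≤s (m∸n<m 1≤m 1≤q))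
  ... | s , e = s , trans e (cong (_++ true ∷ s) (X-suc (m ∸ q)))

  pre : ℕ → List Bool
  pre n = take n (X n)

  length-pre : ∀ n → length (pre n) ≡ n
  length-pre n = length-take-≤ n (X n) (<⇒≤ (length-X n))

  pre-≼ : ∀ n → pre n ≼ X n
  pre-≼ n = take-≼ n (X n)

  ≼X⇒pre : ∀ {u n} → u ≼ X n → u ≡ pre (length u)
  ≼X⇒pre {u} {n} p = ≼-antisym (≼-common (≼-trans p (X-mono (m≤m⊔n n (length u))))
      (≼-trans (pre-≼ (length u)) (X-mono (m≤n⊔m n (length u)))) (≤-reflexive l)) l
    where
    l : length u ≡ length (pre (length u))
    l = sym (length-pre (length u))
    ≼-antisym : ∀ {u v : List Bool} → u ≼ v → length u ≡ length v → u ≡ v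
    ≼-antisym {u} {v} (t , e) l = proj₁ (++-injective u v (trans e (sym (++-identityʳ v))) l)

  -- z is a common prefix of what follows two boundaries of levels m < n (see Boundary below).
  level-mismatch : ∀ {m n} z τ τ′ {s s′ t t′} → 1 ≤ m → m < n →
    z ++ t ≡ (X m ++ τ ⊙ X (suc m)) ++ s → z ++ t′ ≡ (X n ++ τ′ ⊙ X (suc n)) ++ s′ →
    z ≼ X n ⊎ (n ≡ suc m × z ≼ X (suc m) ++ X (m ∸ q ∸ q))
  -- After `X m` the first word restarts with `false`, whereas `X n` goes on with `true`.
  level-mismatch {m} {n} z false τ′ {s} {s′} {t} {t′} 1≤m m<n e e′ with X-head (suc m) | X-<-true m<n
  ... | h , eh | r , er = inj₁ (≼-trans
    (mismatch z (X m) (λ ())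
      (trans e (trans (++-assoc (X m) _ s) (cong (λ v → X m ++ v ++ s) (trans (false-⊙ _) eh))))
      (trans e′ (trans (++-assoc (X n) _ s′) (trans (cong (_++ (τ′ ⊙ X (suc n) ++ s′)) er) (++-assoc (X m) _ _)))))
    (X-mono (<⇒≤ m<n)))
  level-mismatch {m} {n} z true τ′ {s} {s′} {t} {t′} 1≤m m<n e e′ with X-peel m 1≤m
  ... | r , er = second (m≤n⇒m<n∨m≡n m<n) τ′ e′
    where
    Y = X (m ∸ q ∸ q)
    first : z ++ t ≡ (X (suc m) ++ Y) ++ false ∷ true ⊙ r ++ s
    first = begin
      z ++ t                                                             ≡⟨ e ⟩
      (X m ++ true ⊙ X (suc m)) ++ s                                     ≡⟨ cong (λ v → (X m ++ true ⊙ v) ++ s) er ⟩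
      (X m ++ true ⊙ ((X (m ∸ q) ++ true ⊙ Y) ++ true ∷ r)) ++ s         ≡⟨ cong (λ v → (X m ++ v) ++ s) (⊙-++ true (X (m ∸ q) ++ true ⊙ Y) _) ⟩
      (X m ++ true ⊙ (X (m ∸ q) ++ true ⊙ Y) ++ false ∷ true ⊙ r) ++ s   ≡⟨ cong (λ v → (X m ++ v ++ false ∷ true ⊙ r) ++ s)
                                                                              (trans (⊙-++ true (X (m ∸ q)) _) (cong (true ⊙ X (m ∸ q) ++_) (⊙-involutive true Y))) ⟩
      (X m ++ (true ⊙ X (m ∸ q) ++ Y) ++ false ∷ true ⊙ r) ++ s          ≡⟨ cong (_++ s) (++-assoc (X m) _ _) ⟨
      ((X m ++ true ⊙ X (m ∸ q) ++ Y) ++ false ∷ true ⊙ r) ++ s          ≡⟨ cong (λ v → (v ++ false ∷ true ⊙ r) ++ s)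
                                                                              (trans (sym (++-assoc (X m) _ Y)) (cong (_++ Y) (sym (X-suc m)))) ⟩
      ((X (suc m) ++ Y) ++ false ∷ true ⊙ r) ++ s                        ≡⟨ ++-assoc (X (suc m) ++ Y) _ s ⟩
      (X (suc m) ++ Y) ++ false ∷ true ⊙ r ++ s                          ∎
      where open ≡-Reasoning
    first′ : ∃[ v ] (z ++ t ≡ X (suc m) ++ false ∷ v)
    first′ with X-head (m ∸ q ∸ q)
    ... | h , eh = h ++ false ∷ true ⊙ r ++ s , trans first (trans (++-assoc (X (suc m)) Y _) (cong (λ v → X (suc m) ++ v ++ false ∷ true ⊙ r ++ s) eh))
    second : suc m < n ⊎ suc m ≡ n → ∀ τ′ → z ++ t′ ≡ (X n ++ τ′ ⊙ X (suc n)) ++ s′ →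
      z ≼ X n ⊎ (n ≡ suc m × z ≼ X (suc m) ++ Y)
    second (inj₁ l) τ′ e′ with X-<-true l
    ... | v , ev = inj₁ (≼-trans (mismatch z (X (suc m)) (λ ()) (proj₂ first′)
      (trans e′ (trans (++-assoc (X n) _ s′) (trans (cong (_++ (τ′ ⊙ X (suc n) ++ s′)) ev) (++-assoc (X (suc m)) _ _))))) (X-mono (<⇒≤ l)))
    second (inj₂ refl) true e′ with X-head (suc n)
    ... | v , ev = inj₁ (mismatch z (X n) (λ ()) (proj₂ first′)
      (trans e′ (trans (++-assoc (X n) _ s′) (cong (λ v → X n ++ true ⊙ v ++ s′) ev))))
    -- The only case with agreement beyond `X n`: both words continue with `Y`, and only then does
    -- `false` meet `true`.
    second (inj₂ refl) false e′ with X-<-true {m ∸ q ∸ q} {suc n} (s≤s (≤-trans (m∸n≤m _ q) (≤-trans (m∸n≤m m q) (n≤1+n m))))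
    ... | v , ev = inj₂ (refl , mismatch z (X n ++ Y) (λ ()) first
      (trans e′ (trans (++-assoc (X n) _ s′) (trans (cong (λ v → X n ++ v ++ s′) (trans (false-⊙ _) ev))
        (trans (cong (X n ++_) (++-assoc Y _ s′)) (sym (++-assoc (X n) Y _)))))))

  -- Blocks and boundaries

  -- How the last block changes from `X n` to `X (suc n)`: its run grows by one letter, until it has
  -- k letters and the next block starts again with the other sign.
  step : Bool × ℕ → Bool × ℕ
  step (ρ , i) with i ≟ suc q
  ... | yes _ = not ρ , 1
  ... | no _ = ρ , suc i

  flip : Bool × ℕ → Bool × ℕ
  flip (ρ , i) = not ρ , i

  block : Bool × ℕ → List Bool
  block (ρ , i) = ρ ∷ replicate i (not ρ)

  -- block (blk n) is the last block of X n for n ≥ 1; the value at 0 makes the recursion start correctly.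
  blk : ℕ → Bool × ℕ
  blk zero = true , suc q
  blk (suc n) = step (blk n)

  step-flip : ∀ p → step (flip p) ≡ flip (step p)
  step-flip (ρ , i) with i ≟ suc q
  ... | yes _ = refl
  ... | no _ = refl

  step-full : ∀ ρ → step (ρ , suc q) ≡ (not ρ , 1)
  step-full ρ with suc q ≟ suc q
  ... | yes _ = refl
  ... | no ¬p = contradiction refl ¬p

  step-partial : ∀ ρ {i} → i ≢ suc q → step (ρ , i) ≡ (ρ , suc i)
  step-partial ρ {i} ¬p with i ≟ suc q
  ... | yes p = contradiction p ¬p
  ... | no _ = refl

  blk-small : ∀ i → i ≤ q → blk (suc i) ≡ (false , suc i)
  blk-small zero _ = step-full true
  blk-small (suc i) i<q = trans (cong step (blk-small i (<⇒≤ i<q)))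
    (step-partial false (λ e → <⇒≢ i<q (suc-injective e)))

  -- In k steps the run length passes once through all of 1, ..., k, so the sign flips exactly once.
  -- This agrees with `X (suc n)` ending in the negation of `X (n ∸ q)`.
  blk-period : ∀ m → blk (suc m + suc q) ≡ flip (blk (suc m))
  blk-period zero = trans (cong step (blk-small q ≤-refl)) (trans (step-full false) (cong flip (sym (blk-small 0 z≤n))))
  blk-period (suc m) = trans (cong step (blk-period m)) (step-flip (blk (suc m)))

  blk-bounds : ∀ n → 1 ≤ proj₂ (blk n) × proj₂ (blk n) ≤ suc q
  blk-bounds zero = s≤s z≤n , ≤-refl
  blk-bounds (suc n) with blk n | blk-bounds n
  ... | ρ , i | l , h with i ≟ suc q
  ... | yes _ = ≤-refl , s≤s z≤n
  ... | no i≢ = s≤s z≤n , ≤∧≢⇒< h i≢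

  block-flip : ∀ p → block (flip p) ≡ true ⊙ block p
  block-flip (ρ , i) = cong (not ρ ∷_) (sym (⊙-replicate true i (not ρ)))

  block-suc : ∀ n → suc q ≤ n → block (blk (suc n)) ≡ true ⊙ block (blk (n ∸ q))
  block-suc n k≤n with n ∸ q | m<n⇒0<n∸m k≤n | m∸n+n≡m (<⇒≤ k≤n)
  ... | suc m | _ | refl = trans (cong block (trans (cong blk (cong suc (sym (+-suc m q)))) (blk-period m))) (block-flip (blk (suc m)))

  X-block : ∀ n → suc n ≤ suc q → X (suc n) ≡ block (blk (suc n))
  X-block n n≤q = trans (X-small (suc n) n≤q) (cong block (sym (blk-small n (≤-pred n≤q))))

  X-ends : ∀ n → 1 ≤ n → Suffix (block (blk n)) (X n)
  X-ends = <-rec _ go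
    where
    go : ∀ n → (∀ {m} → m < n → 1 ≤ m → Suffix (block (blk m)) (X m)) → 1 ≤ n → Suffix (block (blk n)) (X n)
    go (suc n) rec _ with suc n ≤? suc q
    ... | yes n≤q = [] , sym (X-block n n≤q)
    ... | no n≰q = subst₂ Suffix (sym (block-suc n k≤n)) (sym (X-suc n))
        (Suffix-++ˡ (X n) (⊙-Suffix true (rec (s≤s (m∸n≤m n q)) (m<n⇒0<n∸m k≤n))))
      where
      k≤n : suc q ≤ n
      k≤n = ≤-pred (≰⇒> n≰q)

  -- A cut between c and v: v first completes, by rest, the block containing c,
  -- and then runs through a boundary of level m.
  record Boundary (c : Bool) (v : List Bool) : Set where
    constructor boundary
    field
      {level} : ℕ
      sign following : Bool
      {rest after} : List Bool
      level≥1 : 1 ≤ level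
      past : Suffix (c ∷ rest) (not sign ⊙ block (blk (q + level)))
      future : v ≡ rest ++ sign ⊙ (X level ++ following ⊙ X (suc level)) ++ after

  -- A position in `X n` with `c` before it and `w` remaining. Either a boundary is met under every
  -- continuation by a signed `X (n ∸ q)`, the form in which the recursion always continues `X n`,
  -- or the position lies in the last block and its boundary depends on what comes after `X n`.
  Cut : ℕ → Bool → List Bool → Set
  Cut n c w = (∀ τ s → Boundary c (w ++ τ ⊙ X (n ∸ q) ++ s)) ⊎ Suffix (c ∷ w) (block (blk n))

  boundary-⊙ : ∀ s {c v} → Boundary c v → Boundary (s xor c) (s ⊙ v)
  boundary-⊙ s {c} (boundary {m} σ τ {u} {t} l p refl) = boundary (s xor σ) τ {s ⊙ u} {s ⊙ t} l
    (subst (Suffix _) (trans (⊙-⊙ s (not σ) _) (cong (_⊙ block (blk (q + m))) (sym (not-distribʳ-xor s σ)))) (⊙-Suffix s p))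
    (trans (⊙-++ s u _) (cong (s ⊙ u ++_) (trans (⊙-++ s _ t) (cong (_++ s ⊙ t) (⊙-⊙ s σ _)))))

  -- From the last block of `X n` one reaches the middle of X n · ¬X (n-q). It is a boundary of sign
  -- `true` and level `n ∸ q`, because q + (n - q) = n is the index of the word before it; n ≥ k
  -- makes the level positive.
  cut-boundary : ∀ {n} → suc q ≤ n → ∀ {c w} → Cut n c w → ∀ τ s →
    Boundary c (w ++ true ⊙ X (n ∸ q) ++ τ ⊙ X (suc n ∸ q) ++ s)
  cut-boundary k≤n (inj₁ f) τ s = f true _
  cut-boundary {n} k≤n {c} {w} (inj₂ p) τ s = boundary {level = n ∸ q} true (not τ) (m<n⇒0<n∸m k≤n)
    (subst (Suffix _) (trans (cong (λ m → block (blk m)) (sym (m+[n∸m]≡n (<⇒≤ k≤n)))) (sym (false-⊙ _))) p)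
    (cong (w ++_) (begin
      true ⊙ X (n ∸ q) ++ τ ⊙ X (suc n ∸ q) ++ s                 ≡⟨ ++-assoc (true ⊙ X (n ∸ q)) _ s ⟨
      (true ⊙ X (n ∸ q) ++ τ ⊙ X (suc n ∸ q)) ++ s               ≡⟨ cong (λ m → (true ⊙ X (n ∸ q) ++ τ ⊙ X m) ++ s) (+-∸-assoc 1 (<⇒≤ k≤n)) ⟩
      (true ⊙ X (n ∸ q) ++ τ ⊙ X (suc (n ∸ q))) ++ s             ≡⟨ cong (λ v → (true ⊙ X (n ∸ q) ++ v) ++ s)
                                                                     (trans (⊙-⊙ true (not τ) _) (cong (_⊙ _) (not-involutive τ))) ⟨
      (true ⊙ X (n ∸ q) ++ true ⊙ not τ ⊙ X (suc (n ∸ q))) ++ s  ≡⟨ cong (_++ s) (⊙-++ true (X (n ∸ q)) _) ⟨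
      true ⊙ (X (n ∸ q) ++ not τ ⊙ X (suc (n ∸ q))) ++ s         ∎))
    where open ≡-Reasoning

  cut : ∀ n → 1 ≤ n → ∀ a c w → X n ≡ a ++ c ∷ w → Cut n c w
  cut = <-rec _ go
    where
    go : ∀ n → (∀ {m} → m < n → 1 ≤ m → ∀ a c w → X m ≡ a ++ c ∷ w → Cut m c w) →
      1 ≤ n → ∀ a c w → X n ≡ a ++ c ∷ w → Cut n c w
    go (suc n) rec _ a c w e with suc n ≤? suc q
    ... | yes n≤q = inj₂ (a , trans (sym e) (X-block n n≤q))
    ... | no n≰q = cases (++-split (X n) (true ⊙ X (n ∸ q)) a (c ∷ w) (trans (sym (X-suc n)) e))
      where
      k≤n : suc q ≤ n
      k≤n = ≤-pred (≰⇒> n≰q)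

      second : ∀ a′ → true ⊙ X (n ∸ q) ≡ a′ ++ c ∷ w → Cut (suc n) c w
      second a′ e′ with rec (s≤s (m∸n≤m n q)) (m<n⇒0<n∸m k≤n) (true ⊙ a′) (not c) (true ⊙ w)
        (trans (sym (⊙-involutive true _)) (trans (cong (true ⊙_) e′) (⊙-++ true a′ (c ∷ w))))
      ... | inj₂ p = inj₂ (subst₂ Suffix (cong₂ _∷_ (not-involutive c) (⊙-involutive true w))
              (sym (block-suc n k≤n)) (⊙-Suffix true p))
      -- The continuation required by the copy of `X (n ∸ q)` is a prefix of the one available after
      -- `X (suc n)`.
      ... | inj₁ f with X-mono {n ∸ q ∸ q} {suc n ∸ q} (≤-trans (m∸n≤m _ q) (∸-monoˡ-≤ q (n≤1+n n)))
      ... | r , er = inj₁ (λ τ s → subst₂ Boundary (not-involutive c) (begin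
          true ⊙ (true ⊙ w ++ not τ ⊙ Y ++ true ⊙ (τ ⊙ r ++ s))             ≡⟨ ⊙-++ true (true ⊙ w) _ ⟩
          true ⊙ true ⊙ w ++ true ⊙ (not τ ⊙ Y ++ true ⊙ (τ ⊙ r ++ s))      ≡⟨ cong₂ _++_ (⊙-involutive true w) (⊙-++ true (not τ ⊙ Y) _) ⟩
          w ++ true ⊙ not τ ⊙ Y ++ true ⊙ true ⊙ (τ ⊙ r ++ s)               ≡⟨ cong₂ (λ u v → w ++ u ++ v)
                                                                              (trans (⊙-⊙ true (not τ) Y) (cong (_⊙ Y) (not-involutive τ))) (⊙-involutive true _) ⟩
          w ++ τ ⊙ Y ++ τ ⊙ r ++ s                                          ≡⟨ cong (w ++_) (trans (sym (++-assoc (τ ⊙ Y) _ s)) (cong (_++ s) (sym (⊙-++ τ Y r)))) ⟩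
          w ++ τ ⊙ (Y ++ r) ++ s                                            ≡⟨ cong (λ v → w ++ τ ⊙ v ++ s) er ⟩
          w ++ τ ⊙ X (suc n ∸ q) ++ s                                       ∎)
          (boundary-⊙ true (f (not τ) (true ⊙ (τ ⊙ r ++ s)))))
        where
        open ≡-Reasoning
        Y = X (n ∸ q ∸ q)

      cases : (∃[ d ] (X n ≡ a ++ d × c ∷ w ≡ d ++ true ⊙ X (n ∸ q))) ⊎
        (∃[ d ] (a ≡ X n ++ d × true ⊙ X (n ∸ q) ≡ d ++ c ∷ w)) → Cut (suc n) c w
      cases (inj₁ ([] , e₁ , e₂)) = second [] (sym e₂)
      cases (inj₁ (_ ∷ w′ , e₁ , refl)) = inj₁ (λ τ s → subst (Boundary c) (sym (++-assoc w′ _ _))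
        (cut-boundary k≤n (rec ≤-refl (≤-trans (s≤s z≤n) k≤n) a c w′ e₁) τ s))
      cases (inj₂ (d , _ , e₂)) = second d e₂

  -- Left special factors

  InL : List Bool → Set
  InL w = ∃[ n ] Infix w (X n)

  factor-boundary : ∀ {c w} → InL (c ∷ w) → ∃[ t ] Boundary c (w ++ t)
  factor-boundary {c} {w} (n , a , b , e) with X-mono {n} {n ⊔ suc q} (m≤m⊔n n (suc q))
  ... | r , er = _ , subst (Boundary c) (++-assoc w (b ++ r) _)
      (cut-boundary (m≤n⊔m n (suc q))
        (cut (n ⊔ suc q) (≤-trans (s≤s z≤n) (m≤n⊔m n (suc q))) a c (w ++ b ++ r)
          (trans (sym er) (trans (cong (_++ r) (sym e)) (trans (++-assoc a _ r) (cong (λ v → a ++ c ∷ v) (++-assoc w b r))))))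
        false [])

  sgn : Bool → ℕ → Bool
  sgn σ m = σ xor proj₁ (blk (q + m))

  len : ℕ → ℕ
  len m = proj₂ (blk (q + m))

  -- A block preceding a boundary of sign σ and level m is not b, b, …, b with b = sgn σ m repeated len m times;
  -- c is its letter followed by r further ones.
  Past : Bool → ℕ → ℕ → Bool → Set
  Past σ m r c = (r < len m × c ≡ sgn σ m) ⊎ (r ≡ len m × c ≡ not (sgn σ m))

  Suffix-replicate : ∀ i {b c : Bool} {u} → Suffix (c ∷ u) (replicate i b) → ∃[ r ] (u ≡ replicate r b × r < i × c ≡ b)
  Suffix-replicate (suc i) ([] , refl) = i , refl , ≤-refl , refl
  Suffix-replicate (suc i) (x ∷ t , e) with Suffix-replicate i (t , proj₂ (∷-injective e))
  ... | r , e₁ , r<i , e₂ = r , e₁ , m<n⇒m<1+n r<i , e₂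
  Suffix-replicate zero ([] , ())
  Suffix-replicate zero (x ∷ t , ())

  block-⊙ : ∀ σ m → not σ ⊙ block (blk (q + m)) ≡ not (sgn σ m) ∷ replicate (len m) (sgn σ m)
  block-⊙ σ m = cong₂ _∷_ (sym (not-distribˡ-xor σ _))
    (trans (⊙-replicate (not σ) (len m) _) (cong (replicate (len m))
      (trans (sym (not-distribʳ-xor (not σ) _)) (trans (cong not (sym (not-distribˡ-xor σ _))) (not-involutive _)))))

  past-letters : ∀ {σ m c u} → Suffix (c ∷ u) (not σ ⊙ block (blk (q + m))) → ∃[ r ] (u ≡ replicate r (sgn σ m) × Past σ m r c)
  past-letters {σ} {m} {c} {u} p with subst (Suffix (c ∷ u)) (block-⊙ σ m) p
  ... | [] , refl = len m , refl , inj₂ (refl , refl)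
  ... | x ∷ t , e with Suffix-replicate (len m) (t , proj₂ (∷-injective e))
  ... | r , e₁ , r<i , e₂ = r , e₁ , inj₁ (r<i , e₂)

  past-unique : ∀ {σ m r c c′} → Past σ m r c → Past σ m r c′ → c ≡ c′
  past-unique (inj₁ (_ , refl)) (inj₁ (_ , refl)) = refl
  past-unique (inj₂ (_ , refl)) (inj₂ (_ , refl)) = refl
  past-unique (inj₁ (l , _)) (inj₂ (e , _)) = contradiction e (<⇒≢ l)
  past-unique (inj₂ (e , _)) (inj₁ (l , _)) = contradiction e (<⇒≢ l)

  past-≤ : ∀ {σ m r c} → Past σ m r c → r ≤ len m
  past-≤ (inj₁ (l , _)) = <⇒≤ l
  past-≤ (inj₂ (e , _)) = ≤-reflexive e

  past-full : ∀ {σ m r c} → Past σ m r c → len m ≤ r → c ≡ not (sgn σ m)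
  past-full (inj₁ (l , _)) l′ = contradiction l′ (<⇒≱ l)
  past-full (inj₂ (_ , e)) _ = e

  replicate-head : ∀ {r} {b b′ : Bool} → 1 ≤ r → replicate r b ≡ replicate r b′ → b ≡ b′
  replicate-head (s≤s _) e = proj₁ (∷-injective e)

  -- If r were k, the run would fill both blocks, and both `c` and `c′` would be the negation of its
  -- letter.
  past-<-full : ∀ {σ m n r c c′} → Past σ m r c → Past σ n r c′ → c ≢ c′ →
    replicate r (sgn σ m) ≡ replicate r (sgn σ n) → r ≤ q
  past-<-full {σ} {m} {n} {r} p p′ c≢c′ e with r ≤? q
  ... | yes r≤q = r≤q
  ... | no r≰q = contradiction
      (trans (past-full {σ} {m} p (≤-trans (proj₂ (blk-bounds (q + m))) (≰⇒> r≰q)))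
        (trans (cong not (replicate-head {r} (≤-trans (s≤s z≤n) (≰⇒> r≰q)) e))
          (sym (past-full {σ} {n} p′ (≤-trans (proj₂ (blk-bounds (q + n))) (≰⇒> r≰q)))))) c≢c′

  -- The common suffix of the pasts of the levels m and suc m has length common m.
  common : ℕ → ℕ
  common m with len m ≟ suc q
  ... | yes _ = 0
  ... | no _ = len m

  blk-suc : ∀ m → blk (q + suc m) ≡ step (blk (q + m))
  blk-suc m = cong blk (+-suc q m)

  -- When `len m` is k, the next block repeats the opposite letter and the two pasts differ at once.
  -- Otherwise the next block has the same run with one more letter, so they part exactly in front
  -- of the shorter run.
  past-common : ∀ {σ m r c c′} → Past σ m r c → Past σ (suc m) r c′ → c ≢ c′ →
    replicate r (sgn σ m) ≡ replicate r (sgn σ (suc m)) → r ≡ common m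
  past-common {σ} {m} {r} {c} {c′} p p′ c≢c′ e with len m ≟ suc q
  past-common {r = zero} p p′ c≢c′ e | yes _ = refl
  past-common {σ} {m} {suc r} p p′ c≢c′ e | yes l = contradiction sgn-suc (not-¬ (replicate-head {suc r} (s≤s z≤n) e))
    where
    sgn-suc : sgn σ m ≡ not (sgn σ (suc m))
    sgn-suc = sym (trans (cong (λ p → not (σ xor proj₁ p)) (trans (blk-suc m) (trans (cong (λ i → step (proj₁ (blk (q + m)) , i)) l) (step-full _))))
      (trans (cong not (sym (not-distribʳ-xor σ _))) (not-involutive _)))
  ... | no l≢ = go p p′
    where
    eb : blk (q + suc m) ≡ (proj₁ (blk (q + m)) , suc (len m))
    eb = trans (blk-suc m) (step-partial _ l≢)
    go : Past σ m r c → Past σ (suc m) r c′ → r ≡ len m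
    go (inj₂ (e , _)) _ = e
    go (inj₁ (l , ec)) (inj₁ (_ , ec′)) = contradiction (trans ec (trans (cong (λ p → σ xor proj₁ p) (sym eb)) (sym ec′))) c≢c′
    go (inj₁ (l , _)) (inj₂ (e , _)) = contradiction (trans e (cong proj₂ eb)) (<⇒≢ (m<n⇒m<1+n l))

  -- The possible first letters after a boundary; they are what pins down its position.
  data Start : List Bool → Set where
    long  : ∀ σ s → Start (σ ∷ not σ ∷ not σ ∷ s)
    short : ∀ σ s → Start (σ ∷ not σ ∷ σ ∷ not σ ∷ not σ ∷ s)

  X-1 : X 1 ≡ false ∷ true ∷ []
  X-1 = X-small 1 (s≤s z≤n)

  X-2 : X 2 ≡ false ∷ true ∷ true ∷ []
  X-2 = X-small 2 (s≤s 1≤q)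

  start-⊙ : ∀ σ {f} → Start f → Start (σ ⊙ f)
  start-⊙ false (long σ s) = long σ _
  start-⊙ true (long σ s) = long (not σ) _
  start-⊙ false (short σ s) = short σ _
  start-⊙ true (short σ s) = short (not σ) _

  start-++ : ∀ {f} s → Start f → Start (f ++ s)
  start-++ s (long σ s′) = long σ _
  start-++ s (short σ s′) = short σ _

  X-start : ∀ {m} → 2 ≤ m → Start (X m)
  X-start l with X-mono l
  ... | s , e = subst Start (trans (cong (_++ s) (sym X-2)) e) (long false s)

  boundary-start : ∀ m σ τ s → 1 ≤ m → Start (σ ⊙ (X m ++ τ ⊙ X (suc m)) ++ s)
  boundary-start (suc zero) σ false s _ = start-++ s (start-⊙ σ
    (subst Start (sym (cong₂ (λ u v → u ++ false ⊙ v) X-1 X-2)) (short false [])))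
  boundary-start (suc zero) σ true s _ = start-++ s (start-⊙ σ
    (subst Start (sym (cong₂ (λ u v → u ++ true ⊙ v) X-1 X-2)) (long false _)))
  boundary-start (suc (suc m)) σ τ s _ = start-++ s (start-⊙ σ (start-++ _ (X-start (s≤s (s≤s z≤n)))))

  -- A start has different first letters, which leaves only `zero` for `r`. The first double letter
  -- of a start occupies places 2, 3 or 4, 5; after one extra letter it would occupy 3, 4 or 5, 6.
  -- Five letters suffice to see the difference.
  no-shift : ∀ r b {w f g t t′} → 5 ≤ length w → Start f → Start g →
    w ++ t ≡ f → w ++ t′ ≡ b ∷ replicate r b ++ g → ⊥
  no-shift r b {_ ∷ []} (s≤s ())
  no-shift r b {_ ∷ _ ∷ []} (s≤s (s≤s ()))
  no-shift r b {_ ∷ _ ∷ _ ∷ []} (s≤s (s≤s (s≤s ())))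
  no-shift r b {_ ∷ _ ∷ _ ∷ _ ∷ []} (s≤s (s≤s (s≤s (s≤s ()))))
  no-shift zero b {_ ∷ _ ∷ _ ∷ _ ∷ _ ∷ _} _ (long true s) (long σ s′) refl ()
  no-shift zero b {_ ∷ _ ∷ _ ∷ _ ∷ _ ∷ _} _ (long false s) (long σ s′) refl ()
  no-shift zero b {_ ∷ _ ∷ _ ∷ _ ∷ _ ∷ _} _ (long true s) (short σ s′) refl ()
  no-shift zero b {_ ∷ _ ∷ _ ∷ _ ∷ _ ∷ _} _ (long false s) (short σ s′) refl ()
  no-shift zero b {_ ∷ _ ∷ _ ∷ _ ∷ _ ∷ _} _ (short true s) (long σ s′) refl ()
  no-shift zero b {_ ∷ _ ∷ _ ∷ _ ∷ _ ∷ _} _ (short false s) (long σ s′) refl ()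
  no-shift zero b {_ ∷ _ ∷ _ ∷ _ ∷ _ ∷ _} _ (short true s) (short σ s′) refl ()
  no-shift zero b {_ ∷ _ ∷ _ ∷ _ ∷ _ ∷ _} _ (short false s) (short σ s′) refl ()
  no-shift (suc r) b {_ ∷ _ ∷ _ ∷ _ ∷ _ ∷ _} _ (long true s) _ refl ()
  no-shift (suc r) b {_ ∷ _ ∷ _ ∷ _ ∷ _ ∷ _} _ (long false s) _ refl ()
  no-shift (suc r) b {_ ∷ _ ∷ _ ∷ _ ∷ _ ∷ _} _ (short true s) _ refl ()
  no-shift (suc r) b {_ ∷ _ ∷ _ ∷ _ ∷ _ ∷ _} _ (short false s) _ refl ()

  -- Two readings of `w` therefore meet their boundaries at the same place. Common letters are
  -- removed until one run is used up, and `no-shift` excludes a remainder of the other.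
  synchronised : ∀ r r′ {b b′ w f g t t′} → r + 5 ≤ length w → r′ + 5 ≤ length w → Start f → Start g →
    w ++ t ≡ replicate r b ++ f → w ++ t′ ≡ replicate r′ b′ ++ g → r ≡ r′
  synchronised zero zero _ _ _ _ _ _ = refl
  synchronised zero (suc r′) {w = w} l l′ F G e e′ = ⊥-elim (no-shift r′ _ {w} l F G e e′)
  synchronised (suc r) zero {w = w} l l′ F G e e′ = ⊥-elim (no-shift r _ {w} l′ G F e′ e)
  synchronised (suc r) (suc r′) {w = x ∷ w} l l′ F G e e′ =
    cong suc (synchronised r r′ {w = w} (≤-pred l) (≤-pred l′) F G (proj₂ (∷-injective e)) (proj₂ (∷-injective e′)))

  data Special (w : List Bool) : Set where
    regular : ∀ r b σ z n → r ≤ q → w ≡ replicate r b ++ σ ⊙ z → z ≼ X n → Special w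
    exceptional : ∀ m σ z → 1 ≤ m → w ≡ replicate (common m) (sgn σ m) ++ σ ⊙ z → z ≼ X (suc m) ++ X (m ∸ q ∸ q) → Special w

  special-< : ∀ {σ m n r c c′ w z τ τ′ s s′ t t′} → 1 ≤ m → m < n → Past σ m r c → Past σ n r c′ → c ≢ c′ →
    replicate r (sgn σ m) ≡ replicate r (sgn σ n) → w ≡ replicate r (sgn σ m) ++ z →
    z ++ t ≡ σ ⊙ (X m ++ τ ⊙ X (suc m)) ++ s → z ++ t′ ≡ σ ⊙ (X n ++ τ′ ⊙ X (suc n)) ++ s′ → Special w
  special-< {σ} {m} {n} {r} {w = w} {z} {τ} {τ′} 1≤m m<n p p′ c≢c′ er ew e e′
    with level-mismatch (σ ⊙ z) τ τ′ 1≤m m<n (unsign (X m ++ τ ⊙ X (suc m)) e) (unsign (X n ++ τ′ ⊙ X (suc n)) e′)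
    where
    unsign : ∀ v {t s} → z ++ t ≡ σ ⊙ v ++ s → σ ⊙ z ++ σ ⊙ t ≡ v ++ σ ⊙ s
    unsign v {t} {s} e = trans (sym (⊙-++ σ z t)) (trans (cong (σ ⊙_) e)
      (trans (⊙-++ σ (σ ⊙ v) s) (cong (_++ σ ⊙ s) (⊙-involutive σ v))))
  ... | inj₁ l = regular r (sgn σ m) σ (σ ⊙ z) n (past-<-full {σ} {m} {n} p p′ c≢c′ er)
      (trans ew (cong (replicate r (sgn σ m) ++_) (sym (⊙-involutive σ z)))) l
  ... | inj₂ (refl , l) = exceptional m σ (σ ⊙ z) 1≤m
      (trans ew (cong₂ (λ i v → replicate i (sgn σ m) ++ v) (past-common {σ} {m} p p′ c≢c′ er) (sym (⊙-involutive σ z)))) l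

  boundary-sign : ∀ {z σ σ′ m n v v′ s s′ t t′} → 1 ≤ length z → z ++ t ≡ σ ⊙ (X m ++ v) ++ s → z ++ t′ ≡ σ′ ⊙ (X n ++ v′) ++ s′ → σ ≡ σ′
  boundary-sign {z = x ∷ z} {σ} {σ′} {m} {n} _ e e′ with X m | X-head m | X n | X-head n
  ... | _ | _ , refl | _ | _ , refl = trans (sym (xor-identityʳ σ)) (trans (sym (proj₁ (∷-injective e)))
      (trans (proj₁ (∷-injective e′)) (xor-identityʳ σ′)))

  -- Each extension provides a boundary. Their places agree by `synchronised`, their signs by the
  -- first letter after the boundary, and equal levels would force `c ≡ c′`. The length bound leaves
  -- room for a run of up to k letters and the five letters of a start.
  left-special : ∀ {c c′ w} → c ≢ c′ → suc q + 6 ≤ length w → InL (c ∷ w) → InL (c′ ∷ w) → Special w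
  left-special {c} {c′} {w} c≢c′ lw i i′ with factor-boundary i | factor-boundary i′
  ... | t , boundary {m} σ τ {u} {s} 1≤m p e | t′ , boundary {n} σ′ τ′ {u′} {s′} 1≤n p′ e′
    with past-letters {σ} {m} p | past-letters {σ′} {n} p′
  ... | r , refl , P | r′ , refl , P′
    with synchronised r r′ {w = w} (≤-trans (fits {σ} {m} P) lw) (≤-trans (fits {σ′} {n} P′) lw)
           (boundary-start m σ τ s 1≤m) (boundary-start n σ′ τ′ s′ 1≤n) e e′
    where
    fits : ∀ {σ m r c} → Past σ m r c → r + 5 ≤ suc q + 6
    fits {σ} {m} P = +-mono-≤ (≤-trans (past-≤ {σ} {m} P) (proj₂ (blk-bounds (q + m)))) (n≤1+n 5)
  ... | refl with ≼-linear (replicate r (sgn σ m)) w (sym e) (≤-trans (≤-reflexive (length-replicate r)) r≤w)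
    where
    r≤w : r ≤ length w
    r≤w = ≤-trans (≤-trans (past-≤ {σ} {m} P) (proj₂ (blk-bounds (q + m)))) (≤-trans (m≤m+n (suc q) 6) lw)
  ... | z , ew with ++-injective (replicate r (sgn σ m)) (replicate r (sgn σ′ n))
           (trans (trans (sym (++-assoc _ z t′)) (cong (_++ t′) ew)) e′) (trans (length-replicate r) (sym (length-replicate r)))
  ... | er , ez′ with ++-cancelˡ (replicate r (sgn σ m)) (z ++ t) _ (trans (trans (sym (++-assoc _ z t)) (cong (_++ t) ew)) e)
  ... | ez with boundary-sign {z} {σ} {σ′} {m} {n} {τ ⊙ X (suc m)} {τ′ ⊙ X (suc n)} lz ez ez′
    where
    lz : 1 ≤ length z
    lz = +-cancelˡ-≤ r 1 _ (begin
      r + 1                                       ≤⟨ +-mono-≤ (≤-trans (past-≤ {σ} {m} P) (proj₂ (blk-bounds (q + m)))) (s≤s z≤n) ⟩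
      suc q + 6                                   ≤⟨ lw ⟩
      length w                                    ≡⟨ cong length ew ⟨
      length (replicate r (sgn σ m) ++ z)         ≡⟨ length-++ (replicate r (sgn σ m)) ⟩
      length (replicate r (sgn σ m)) + length z   ≡⟨ cong (_+ length z) (length-replicate r) ⟩
      r + length z                                ∎)
      where open ≤-Reasoning
  ... | refl with <-cmp m n
  ... | tri< m<n _ _ = special-< {σ} {m} {n} {z = z} {τ} {τ′} 1≤m m<n P P′ c≢c′ er (sym ew) ez ez′
  ... | tri> _ _ n<m = special-< {σ} {n} {m} {z = z} {τ′} {τ} 1≤n n<m P′ P (λ e → c≢c′ (sym e)) (sym er)
      (trans (sym ew) (cong (_++ z) er)) ez′ ez
  ... | tri≈ _ refl _ = contradiction (past-unique {σ} {m} P P′) c≢c′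

  -- Existence of factors

  InL-infix : ∀ {u v} → Infix u v → InL v → InL u
  InL-infix i (n , j) = n , Infix-trans i j

  X-add : ∀ n → X (suc (n + q)) ≡ X (n + q) ++ true ⊙ X n
  X-add n = trans (X-suc (n + q)) (cong (λ m → X (n + q) ++ true ⊙ X m) (m+n∸n≡m n q))

  InL-⊙ : ∀ s {w} → InL w → InL (s ⊙ w)
  InL-⊙ false {w} i = subst InL (sym (false-⊙ w)) i
  InL-⊙ true (n , i) = suc (n + q) , Infix-trans (Infix-map not i) (Suffix⇒Infix (X (n + q) , sym (X-add n)))

  -- Two uses of the recursion give X (n+q+2) = X (n+q) · ¬X n · ¬X (n+1); the pair is the negation
  -- of the end of this word.
  InL-pair : ∀ n → InL (X n ++ X (suc n))
  InL-pair n = subst InL (trans (⊙-++ true (true ⊙ X n) _) (cong₂ _++_ (⊙-involutive true (X n)) (⊙-involutive true (X (suc n)))))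
    (InL-⊙ true (suc (suc n + q) , Suffix⇒Infix (X (n + q) , trans (sym (++-assoc (X (n + q)) _ _))
      (trans (cong (_++ true ⊙ X (suc n)) (sym (X-add n))) (sym (X-add (suc n)))))))

  -- For `false` the word is X (m+q+2) itself. For `true` it is X (m+q+1) · X (m+1), the beginning
  -- of a pair as in `InL-pair`.
  junction⁺ : ∀ m τ → InL (X (m + q) ++ true ⊙ (X m ++ τ ⊙ X (suc m)))
  junction⁺ m false = suc (suc m + q) , [] , [] , trans (++-identityʳ _) (begin
    X (m + q) ++ true ⊙ (X m ++ false ⊙ X (suc m))    ≡⟨ cong (λ v → X (m + q) ++ true ⊙ (X m ++ v)) (false-⊙ _) ⟩
    X (m + q) ++ true ⊙ (X m ++ X (suc m))            ≡⟨ cong (X (m + q) ++_) (⊙-++ true (X m) _) ⟩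
    X (m + q) ++ true ⊙ X m ++ true ⊙ X (suc m)       ≡⟨ ++-assoc (X (m + q)) _ _ ⟨
    (X (m + q) ++ true ⊙ X m) ++ true ⊙ X (suc m)     ≡⟨ cong (_++ true ⊙ X (suc m)) (X-add m) ⟨
    X (suc m + q) ++ true ⊙ X (suc m)                 ≡⟨ X-add (suc m) ⟨
    X (suc (suc m + q))                               ∎)
    where open ≡-Reasoning
  junction⁺ m true = InL-infix (≼⇒Infix (subst (_≼ X (suc m + q) ++ X (suc (suc m + q))) eq
      (≼-++ˡ (X (suc m + q)) (X-mono (s≤s (≤-trans (m≤m+n m q) (n≤1+n _))))))) (InL-pair (suc m + q))
    where
    open ≡-Reasoning
    eq : X (suc m + q) ++ X (suc m) ≡ X (m + q) ++ true ⊙ (X m ++ true ⊙ X (suc m))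
    eq = begin
      X (suc m + q) ++ X (suc m)                             ≡⟨ cong (_++ X (suc m)) (X-add m) ⟩
      (X (m + q) ++ true ⊙ X m) ++ X (suc m)                 ≡⟨ ++-assoc (X (m + q)) _ _ ⟩
      X (m + q) ++ true ⊙ X m ++ X (suc m)                   ≡⟨ cong (λ v → X (m + q) ++ true ⊙ X m ++ v) (⊙-involutive true _) ⟨
      X (m + q) ++ true ⊙ X m ++ true ⊙ true ⊙ X (suc m)     ≡⟨ cong (X (m + q) ++_) (⊙-++ true (X m) _) ⟨
      X (m + q) ++ true ⊙ (X m ++ true ⊙ X (suc m))          ∎

  junction : ∀ σ m τ → InL (not σ ⊙ X (q + m) ++ σ ⊙ (X m ++ τ ⊙ X (suc m)))
  junction σ m τ = subst InL (trans (⊙-++ (not σ) (X (m + q)) _)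
      (cong₂ (λ n v → not σ ⊙ X n ++ v) (+-comm m q) (trans (⊙-⊙ (not σ) true _) (cong (_⊙ (X m ++ τ ⊙ X (suc m))) (flips σ)))))
    (InL-⊙ (not σ) (junction⁺ m τ))
    where
    flips : ∀ σ → not σ xor true ≡ σ
    flips false = refl
    flips true = refl

  replicate-suffix : ∀ {r i} (b : Bool) → r < i → Suffix (b ∷ replicate r b) (replicate i b)
  replicate-suffix {r} {suc i} b (s≤s r≤i) with m≤n⇒m<n∨m≡n r≤i
  ... | inj₂ refl = [] , refl
  ... | inj₁ r<i with replicate-suffix b r<i
  ... | t , e = b ∷ t , cong (b ∷_) e

  past-suffix : ∀ {σ m r c} → Past σ m r c → Suffix (c ∷ replicate r (sgn σ m)) (not σ ⊙ block (blk (q + m)))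
  past-suffix {σ} {m} (inj₂ (refl , refl)) = [] , sym (block-⊙ σ m)
  past-suffix {σ} {m} (inj₁ (l , refl)) with replicate-suffix (sgn σ m) l
  ... | t , e = not (sgn σ m) ∷ t , trans (cong (not (sgn σ m) ∷_) e) (sym (block-⊙ σ m))

  past-factor : ∀ {σ m r c} τ {z} → 1 ≤ m → Past σ m r c → z ≼ X m ++ τ ⊙ X (suc m) →
    InL (c ∷ replicate r (sgn σ m) ++ σ ⊙ z)
  past-factor {σ} {m} {r} {c} τ {z} 1≤m p l = InL-infix
    (Infix-trans (≼⇒Infix (≼-++ˡ (c ∷ replicate r (sgn σ m)) (⊙-≼ σ l)))
      (Suffix⇒Infix (Suffix-++ʳ _ (Suffix-trans (past-suffix {σ} {m} p) (⊙-Suffix (not σ) (X-ends (q + m) (≤-trans 1≤m (m≤n+m m q))))))))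
    (junction σ m τ)

  X-peel-≼ : ∀ m → 1 ≤ m → X (suc m) ++ X (m ∸ q ∸ q) ≼ X m ++ true ⊙ X (suc m)
  X-peel-≼ m 1≤m with X-peel m 1≤m
  ... | s , e = subst₂ _≼_
    (trans (cong (X m ++_) (trans (⊙-++ true (X (m ∸ q)) _) (cong (true ⊙ X (m ∸ q) ++_) (⊙-involutive true Y))))
      (trans (sym (++-assoc (X m) _ Y)) (cong (_++ Y) (sym (X-suc m)))))
    (cong (λ v → X m ++ true ⊙ v) (sym e))
    (≼-++ˡ (X m) (⊙-≼ true (≼-++ (X (m ∸ q) ++ true ⊙ Y))))
    where
    Y = X (m ∸ q ∸ q)

  -- The word occurs at a boundary of level m followed by the negated `X (suc m)`, and at one of
  -- level m + 1 followed by `X (suc (suc m))`. The letters in front of the common suffix of the two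
  -- blocks differ, so each `c` comes from one of the levels.
  exceptional-factor : ∀ m σ c {z} → 1 ≤ m → z ≼ X (suc m) ++ X (m ∸ q ∸ q) →
    InL (c ∷ replicate (common m) (sgn σ m) ++ σ ⊙ z)
  exceptional-factor m σ c {z} 1≤m l = cases (c ≟ᵇ sgn σ m)
    where
    lower : z ≼ X m ++ true ⊙ X (suc m)
    lower = ≼-trans l (X-peel-≼ m 1≤m)
    upper : z ≼ X (suc m) ++ false ⊙ X (suc (suc m))
    upper = ≼-trans l (≼-++ˡ (X (suc m)) (subst (X (m ∸ q ∸ q) ≼_) (sym (false-⊙ _))
      (X-mono (≤-trans (m∸n≤m _ q) (≤-trans (m∸n≤m m q) (≤-trans (n≤1+n m) (n≤1+n _)))))))
    cases : Dec (c ≡ sgn σ m) → InL (c ∷ replicate (common m) (sgn σ m) ++ σ ⊙ z)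
    cases d with len m ≟ suc q
    cases (yes e) | yes _ = past-factor {σ} {m} {0} true 1≤m (inj₁ (proj₁ (blk-bounds (q + m)) , e)) lower
    cases (no n) | yes l = past-factor {σ} {suc m} {0} false (s≤s z≤n)
        (inj₁ (proj₁ (blk-bounds (q + suc m)) , trans (¬-not n) (sym sgn-suc))) upper
      where
      sgn-suc : sgn σ (suc m) ≡ not (sgn σ m)
      sgn-suc = trans (cong (λ p → σ xor proj₁ p) (trans (blk-suc m) (trans (cong (λ i → step (proj₁ (blk (q + m)) , i)) l) (step-full _))))
        (sym (not-distribʳ-xor σ _))
    cases (no n) | no _ = past-factor {σ} {m} true 1≤m (inj₂ (refl , ¬-not n)) lower
    cases (yes e) | no l≢ = subst (λ b → InL (c ∷ replicate (len m) b ++ σ ⊙ z)) es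
        (past-factor {σ} {suc m} false (s≤s z≤n) (inj₁ (≤-reflexive (sym (cong proj₂ eb)) , trans e (sym es))) upper)
      where
      eb : blk (q + suc m) ≡ (proj₁ (blk (q + m)) , suc (len m))
      eb = trans (blk-suc m) (step-partial _ l≢)
      es : sgn σ (suc m) ≡ sgn σ m
      es = cong (λ p → σ xor proj₁ p) eb

  par : ℕ → Bool
  par zero = false
  par (suc s) = not (par s)

  blk-par : ∀ s i → i ≤ q → blk (suc i + s * suc q) ≡ (par s , suc i)
  blk-par zero i i≤q = trans (cong (λ n → blk (suc n)) (+-identityʳ i)) (blk-small i i≤q)
  blk-par (suc s) i i≤q = trans (cong (λ n → blk (suc n))
      (trans (cong (i +_) (+-comm (suc q) (s * suc q))) (sym (+-assoc i _ (suc q)))))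
    (trans (blk-period (i + s * suc q)) (cong flip (blk-par s i i≤q)))

  par-above : ∀ n b → ∃[ s ] (n ≤ s × par s ≡ b)
  par-above n b with par n ≟ᵇ b
  ... | yes e = n , ≤-refl , e
  ... | no ne = suc n , n≤1+n n , sym (¬-not (λ e → ne (sym e)))

  -- The pairs `blk` recur with period 2k, so each block stands before boundaries of sign σ at
  -- arbitrarily high levels m, and `X n` is a prefix of `X m` once n ≤ m. The index j = q + m has
  -- run length `suc i`, and the parity of `s` selects the sign.
  block-factor : ∀ ρ i σ n → i ≤ q → InL (block (ρ , suc i) ++ σ ⊙ X n)
  block-factor ρ i σ n i≤q with par-above (suc n) (not σ xor ρ)
  ... | s , n<s , es = subst (λ w → InL (w ++ σ ⊙ X n)) eb
      (past-factor {σ} {m} {len m} false 1≤m (inj₂ (refl , refl)) (≼-trans (X-mono n≤m) (≼-++ (X m))))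
    where
    j = suc i + s * suc q
    m = j ∸ q
    n+q≤j : suc n + q ≤ j
    n+q≤j = begin
      suc n + q      ≤⟨ +-mono-≤ n<s (m≤m*n q s ⦃ >-nonZero (≤-trans (s≤s z≤n) n<s) ⦄) ⟩
      s + q * s      ≡⟨ cong (s +_) (*-comm q s) ⟩
      s + s * q      ≡⟨ *-suc s q ⟨
      s * suc q      ≤⟨ m≤n+m _ (suc i) ⟩
      j              ∎
      where open ≤-Reasoning
    n<m : suc n ≤ m
    n<m = m+n≤o⇒m≤o∸n (suc n) n+q≤j
    n≤m : n ≤ m
    n≤m = <⇒≤ n<m
    1≤m : 1 ≤ m
    1≤m = ≤-trans (s≤s z≤n) n<m
    ej : blk (q + m) ≡ (par s , suc i)
    ej = trans (cong blk (m+[n∸m]≡n (≤-trans (m≤n+m q _) n+q≤j))) (blk-par s i i≤q)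
    eβ : sgn σ m ≡ not ρ
    eβ = trans (cong (λ p → σ xor proj₁ p) ej) (trans (cong (σ xor_) es) (cancel σ ρ))
      where
      cancel : ∀ σ ρ → σ xor (not σ xor ρ) ≡ not ρ
      cancel false ρ = refl
      cancel true ρ = refl
    eb : not (sgn σ m) ∷ replicate (len m) (sgn σ m) ≡ block (ρ , suc i)
    eb = cong₂ _∷_ (trans (cong not eβ) (not-involutive ρ)) (cong₂ replicate (cong proj₂ ej) eβ)

  -- For `c` equal to `b` the word comes from a block with run length r + 1 ≤ k, otherwise from one
  -- with run length r. No block has run length 0, but then `b` does not occur and `full` applies
  -- with `c` as its letter.
  regular-factor : ∀ r b σ c {z n} → r ≤ q → z ≼ X n → InL (c ∷ replicate r b ++ σ ⊙ z)
  regular-factor r b σ c {z} {n} r≤q l = InL-infix (≼⇒Infix (≼-++ˡ (c ∷ replicate r b) (⊙-≼ σ l))) (whole r b r≤q)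
    where
    full : ∀ r b → r ≤ q → InL (b ∷ replicate r b ++ σ ⊙ X n)
    full r b r≤q = InL-infix (Suffix⇒Infix (not b ∷ [] , refl))
      (subst (λ b′ → InL (not b ∷ b′ ∷ replicate r b′ ++ σ ⊙ X n)) (not-involutive b) (block-factor (not b) r σ n r≤q))
    whole : ∀ r b → r ≤ q → InL (c ∷ replicate r b ++ σ ⊙ X n)
    whole r b r≤q with c ≟ᵇ b
    ... | yes refl = full r c r≤q
    whole zero b r≤q | no _ = full 0 c z≤n
    whole (suc r) b r<q | no n≢ = subst (λ b′ → InL (c ∷ replicate (suc r) b′ ++ σ ⊙ X n)) (sym (¬-not (λ e → n≢ (sym e))))
      (block-factor c r σ n (<⇒≤ r<q))

  snoc : ∀ {A : Set} (x : A) v → ∃[ u ] ∃[ y ] (x ∷ v ≡ u ++ y ∷ [])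
  snoc x [] = [] , x , refl
  snoc x (x′ ∷ v) with snoc x′ v
  ... | u , y , e = x ∷ u , y , cong (x ∷_) e

  -- Even a prefix of `X n` has a letter before it somewhere: the negation of `X n` stands after
  -- `X (n + q)` in `X (suc (n + q))`.
  left-extension : ∀ {w} → InL w → ∃[ c ] InL (c ∷ w)
  left-extension {w} (n , a , b , e) with X (n + q) | X-head (n + q) | X-add n
  ... | _ | h , refl | ex with snoc false (h ++ true ⊙ a)
  ... | u , y , es = not y , subst (λ v → InL (not y ∷ v)) (⊙-involutive true w) (InL-⊙ true
      (suc (n + q) , u , true ⊙ b , (begin
        u ++ y ∷ true ⊙ w ++ true ⊙ b                          ≡⟨ ++-assoc u (y ∷ []) _ ⟨
        (u ++ y ∷ []) ++ true ⊙ w ++ true ⊙ b                  ≡⟨ cong (_++ true ⊙ w ++ true ⊙ b) es ⟨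
        false ∷ (h ++ true ⊙ a) ++ true ⊙ w ++ true ⊙ b        ≡⟨ cong (false ∷_) (++-assoc h _ _) ⟩
        false ∷ h ++ true ⊙ a ++ true ⊙ w ++ true ⊙ b          ≡⟨ cong (λ v → false ∷ h ++ true ⊙ a ++ v) (⊙-++ true w b) ⟨
        false ∷ h ++ true ⊙ a ++ true ⊙ (w ++ b)               ≡⟨ cong (λ v → false ∷ h ++ v) (⊙-++ true a _) ⟨
        false ∷ h ++ true ⊙ (a ++ w ++ b)                      ≡⟨ cong (λ v → false ∷ h ++ true ⊙ v) e ⟩
        false ∷ h ++ true ⊙ X n                                ≡⟨ ex ⟨
        X (suc (n + q))                                        ∎)))
    where open ≡-Reasoning

  -- Enumeration of the factors of a given length

  X-add-ends : ∀ m → Suffix (X m) (X (suc (suc (m + q) + q)))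
  X-add-ends m = Suffix-trans (subst (λ v → Suffix v (true ⊙ X (suc (m + q)))) (⊙-involutive true (X m))
      (⊙-Suffix true (X (m + q) , sym (X-add m))))
    (X (suc (m + q) + q) , sym (X-add (suc (m + q))))

  Suffix-common : ∀ {u v w : List Bool} → Suffix u w → Suffix v w → length u ≤ length v → Suffix u v
  Suffix-common {u} {v} (s , refl) (t , e) l with ++-split t v s u e
  ... | inj₂ (d , _ , e₂) = d , sym e₂
  ... | inj₁ ([] , _ , refl) = [] , refl
  ... | inj₁ (x ∷ d , _ , refl) = contradiction l (<⇒≱ (≤-trans (s≤s (m≤n+m (length v) (length d))) (≤-reflexive (cong suc (sym (length-++ d))))))

  -- A factor of length at most N that crosses the middle of a long X (suc n) = X n ++ true ⊙ X (n ∸ q) also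
  -- crosses the middle of an earlier word, since the X m with m in a fixed class modulo 2 (q + 1) have a common end.
  factor-recurrence : ∀ N n {w} → length w ≤ N → Infix w (X n) → ∃[ s ] Infix (s ⊙ w) (X (suc (suc (N + q + q) + q)))
  factor-recurrence N = <-rec _ go
    where
    B = suc (suc (N + q + q) + q)
    go : ∀ n → (∀ {m} → m < n → ∀ {w} → length w ≤ N → Infix w (X m) → ∃[ s ] Infix (s ⊙ w) (X B)) →
      ∀ {w} → length w ≤ N → Infix w (X n) → ∃[ s ] Infix (s ⊙ w) (X B)
    go n rec {w} l i with n ≤? B
    ... | yes n≤B = false , subst (λ v → Infix v (X B)) (sym (false-⊙ w)) (Infix-trans i (≼⇒Infix (X-mono n≤B)))
    go zero rec l i | no n≰B = contradiction z≤n n≰B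
    go (suc n) rec {w} l (a , b , e) | no n≰B = halves (++-split (X n) (true ⊙ X (n ∸ q)) a (w ++ b) (sym (trans e (X-suc n))))
      where
      d = n ∸ B
      -- This is n - 2(q + 1). The summand N + q guarantees that `X m` and `X (m ∸ q)` both have at
      -- least `N` letters.
      m = N + q + d
      n≡ : n ≡ suc (suc (m + q) + q)
      n≡ = trans (sym (m+[n∸m]≡n (≤-pred (≰⇒> n≰B)))) (cong (λ v → suc (suc v)) (begin
        N + q + q + q + d    ≡⟨ +-assoc (N + q + q) q d ⟩
        N + q + q + (q + d)  ≡⟨ cong (N + q + q +_) (+-comm q d) ⟩
        N + q + q + (d + q)  ≡⟨ +-assoc (N + q) q (d + q) ⟩
        N + q + (q + (d + q)) ≡⟨ cong (N + q +_) (trans (sym (+-assoc q d q)) (cong (_+ q) (+-comm q d))) ⟩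
        N + q + (d + q + q)  ≡⟨ cong (N + q +_) (+-assoc d q q) ⟩
        N + q + (d + (q + q)) ≡⟨ +-assoc (N + q) d (q + q) ⟨
        N + q + d + (q + q)  ≡⟨ +-assoc (N + q + d) q q ⟨
        N + q + d + q + q    ∎))
        where open ≡-Reasoning
      N≤m∸q : N ≤ m ∸ q
      N≤m∸q = m+n≤o⇒m≤o∸n N (m≤m+n (N + q) d)
      m≤n : m ≤ n
      m≤n = subst (m ≤_) (sym n≡) (≤-trans (m≤m+n m q) (≤-trans (n≤1+n _) (≤-trans (m≤m+n _ q) (n≤1+n _))))
      sm<sn : suc m < suc n
      sm<sn = s≤s (subst (suc m ≤_) (sym n≡) (s≤s (≤-trans (m≤m+n m q) (≤-trans (n≤1+n _) (m≤m+n _ q)))))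

      crossing : ∀ {u v} → w ≡ u ++ v → Suffix u (X n) → v ≼ true ⊙ X (n ∸ q) → ∃[ s ] Infix (s ⊙ w) (X B)
      crossing {u} {v} refl (t , et) pv = rec sm<sn l (subst (Infix (u ++ v)) (sym (X-suc m))
        (Infix-trans (≼⇒Infix (≼-++ˡ u v≼)) (Suffix⇒Infix (Suffix-++ʳ (true ⊙ X (m ∸ q)) u-end))))
        where
        lu : length u ≤ N
        lu = ≤-trans (m≤m+n _ (length v)) (≤-trans (≤-reflexive (sym (length-++ u))) l)
        lv : length v ≤ N
        lv = ≤-trans (m≤n+m _ (length u)) (≤-trans (≤-reflexive (sym (length-++ u))) l)
        u-end : Suffix u (X m)
        u-end = Suffix-common (t , trans et (cong X n≡)) (X-add-ends m)
          (≤-trans lu (≤-trans N≤m∸q (≤-trans (m∸n≤m m q) (<⇒≤ (length-X m)))))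
        v≼ : v ≼ true ⊙ X (m ∸ q)
        v≼ = ≼-common pv (⊙-≼ true (X-mono (∸-monoˡ-≤ q m≤n)))
          (≤-trans lv (≤-trans N≤m∸q (≤-trans (<⇒≤ (length-X (m ∸ q))) (≤-reflexive (sym (length-⊙ true (X (m ∸ q))))))))

      halves : (∃[ d ] (X n ≡ a ++ d × w ++ b ≡ d ++ true ⊙ X (n ∸ q))) ⊎
        (∃[ d ] (a ≡ X n ++ d × true ⊙ X (n ∸ q) ≡ d ++ w ++ b)) → ∃[ s ] Infix (s ⊙ w) (X B)
      halves (inj₂ (d , _ , e₂)) with rec (s≤s (m∸n≤m n q)) {true ⊙ w} (≤-trans (≤-reflexive (length-⊙ true w)) l)
        (subst (Infix (true ⊙ w)) (⊙-involutive true _) (Infix-map not (d , b , sym e₂)))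
      ... | s , i = s xor true , subst (λ v → Infix v (X B)) (⊙-⊙ s true w) i
      halves (inj₁ (d , e₁ , e₂)) with ++-split w b d (true ⊙ X (n ∸ q)) e₂
      ... | inj₁ (f , e₃ , e₄) = crossing e₃ (a , sym e₁) (b , sym e₄)
      ... | inj₂ (f , e₃ , _) = rec ≤-refl l (a , f , trans (cong (a ++_) (sym e₃)) (sym e₁))

  -- Windows near the end of `v` come out shorter than `n`; `factors` filters them out.
  infixes : ℕ → List Bool → List (List Bool)
  infixes n v = map (λ i → take n (drop i v)) (upTo (suc (length v)))

  infixes-Infix : ∀ n v → All (λ w → Infix w v) (infixes n v)
  infixes-Infix n v = All.map⁺ (All.tabulate {xs = upTo (suc (length v))} (λ {i} _ → each i))
    where
    each : ∀ i → Infix (take n (drop i v)) v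
    each i = Infix-trans {v = drop i v} (≼⇒Infix (take-≼ n (drop i v))) (Suffix⇒Infix (take i v , take++drop≡id i v))

  Infix-infixes : ∀ {w v} → Infix w v → w ∈ infixes (length w) v
  Infix-infixes {w} {v} (a , b , e) = subst (_∈ infixes (length w) v) eq
    (∈-map⁺ _ (∈-upTo⁺ (s≤s (≤-trans (m≤m+n (length a) (length (w ++ b))) (≤-reflexive (trans (sym (length-++ a)) (cong length e)))))))
    where
    eq : take (length w) (drop (length a) v) ≡ w
    eq = trans (cong (λ v → take (length w) (drop (length a) v)) (sym e))
      (trans (cong (take (length w)) (drop-length-++ a (w ++ b))) (sym (≼-take (≼-++ w))))
      where
      drop-length-++ : ∀ (a v : List Bool) → drop (length a) (a ++ v) ≡ v
      drop-length-++ [] v = refl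
      drop-length-++ (x ∷ a) v = drop-length-++ a v

  _≟ᴸ_ : (u v : List Bool) → Dec (u ≡ v)
  _≟ᴸ_ = ≡-dec _≟ᵇ_

  Factors : ℕ → List (List Bool) → Set
  Factors n ws = Unique ws × All (λ w → length w ≡ n × InL w) ws × (∀ w → length w ≡ n → InL w → w ∈ ws)

  factors : ∀ n → ∃[ ws ] Factors n ws
  factors n = deduplicate _≟ᴸ_ cands , deduplicate-! _≟ᴸ_ cands ,
      All.tabulate (λ w∈ → sound (∈-deduplicate⁻ _≟ᴸ_ cands w∈)) ,
      λ w l i → ∈-deduplicate⁺ _≟ᴸ_ (complete w l i)
    where
    V = X (suc (suc (n + q + q) + q))
    -- `factor-recurrence` locates a factor in `V` only up to sign.
    both = infixes n V ++ map (true ⊙_) (infixes n V)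
    cands = filter (λ w → length w ≟ n) both
    both-InL : All InL both
    both-InL = All.++⁺ (All.map (λ i → _ , i) (infixes-Infix n V))
      (All.map⁺ (All.map (λ i → InL-⊙ true (_ , i)) (infixes-Infix n V)))
    sound : ∀ {w} → w ∈ cands → length w ≡ n × InL w
    sound w∈ with ∈-filter⁻ (λ w → length w ≟ n) {xs = both} w∈
    ... | w∈both , l = l , All.lookup both-InL w∈both
    complete : ∀ w → length w ≡ n → InL w → w ∈ cands
    complete w refl (m , i) with factor-recurrence n m {w} ≤-refl i
    ... | false , j = ∈-filter⁺ (λ w → length w ≟ n) (∈-++⁺ˡ (Infix-infixes (subst (λ v → Infix v V) (false-⊙ w) j))) refl
    ... | true , j = ∈-filter⁺ (λ w → length w ≟ n) (∈-++⁺ʳ (infixes n V) (subst (_∈ map (true ⊙_) (infixes n V))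
        (⊙-involutive true w) (∈-map⁺ (true ⊙_) (subst (λ l → true ⊙ w ∈ infixes l V) (length-⊙ true w) (Infix-infixes j))))) refl

  -- The first difference of the complexity

  LeftSpecials : ℕ → List (List Bool) → Set
  LeftSpecials n ls = Unique ls × All (λ w → length w ≡ n × (∀ c → InL (c ∷ w))) ls ×
    (∀ w → length w ≡ n → (∀ c → InL (c ∷ w)) → w ∈ ls)

  extend : ∀ n {ws ls} → Factors n ws → LeftSpecials n ls → ∃[ vs ] (Factors (suc n) vs × length vs ≡ length ws + length ls)
  extend n {ws} {ls} (uws , aws , cws) (uls , als , cls) = vs , (unique , sound , complete) ,
      trans (length-++ (map _ ws)) (cong₂ _+_ (length-map _ ws) (length-map _ ls))
    where
    longer = proj₁ (factors (suc n))

    _∈?_ : ∀ w (vs : List (List Bool)) → Dec (w ∈ vs)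
    w ∈? vs = any? (w ≟ᴸ_) vs

    -- A decidable choice of one left extension: `false` if that word is listed, and otherwise
    -- `true`, which is then an extension by `left-extension`.
    first : List Bool → Bool
    first w = not (does ((false ∷ w) ∈? longer))

    first-InL : ∀ {w} → length w ≡ n → InL w → InL (first w ∷ w)
    first-InL {w} l i with (false ∷ w) ∈? longer | left-extension i
    ... | yes f | _ = proj₂ (All.lookup (proj₁ (proj₂ (proj₂ (factors (suc n))))) f)
    ... | no ¬f | true , j = j
    ... | no ¬f | false , j = contradiction (proj₂ (proj₂ (proj₂ (factors (suc n)))) (false ∷ w) (cong suc l) j) ¬f

    vs = map (λ w → first w ∷ w) ws ++ map (λ w → not (first w) ∷ w) ls

    unique : Unique vs
    unique = Unique.++⁺ (Unique.map⁺ (λ e → proj₂ (∷-injective e)) uws) (Unique.map⁺ (λ e → proj₂ (∷-injective e)) uls) disjoint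
      where
      disjoint : ∀ {v} → v ∈ map (λ w → first w ∷ w) ws × v ∈ map (λ w → not (first w) ∷ w) ls → ⊥
      disjoint (p , r) with ∈-map⁻ _ p | ∈-map⁻ _ r
      ... | w , _ , refl | w′ , _ , e with ∷-injective e
      ... | e₁ , refl = not-¬ {first w} refl e₁

    sound : All (λ v → length v ≡ suc n × InL v) vs
    sound = All.++⁺ (All.map⁺ (All.map (λ (l , i) → cong suc l , first-InL l i) aws))
      (All.map⁺ (All.map (λ (l , i) → cong suc l , i _) als))

    complete : ∀ v → length v ≡ suc n → InL v → v ∈ vs
    complete (c ∷ w) l i with InL-infix (Suffix⇒Infix (c ∷ [] , refl)) i | c ≟ᵇ first w
    ... | iw | yes refl = ∈-++⁺ˡ (∈-map⁺ (λ w → first w ∷ w) (cws w (suc-injective l) iw))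
    ... | iw | no c≢ = ∈-++⁺ʳ _ (subst (λ c → c ∷ w ∈ map (λ w → not (first w) ∷ w) ls) (sym (¬-not c≢))
          (∈-map⁺ (λ w → not (first w) ∷ w) (cls w (suc-injective l) both)))
      where
      both : ∀ c′ → InL (c′ ∷ w)
      both c′ with c′ ≟ᵇ first w
      ... | yes refl = first-InL (suc-injective l) iw
      ... | no c′≢ = subst (λ c → InL (c ∷ w)) (trans (¬-not c≢) (sym (¬-not c′≢))) i

  -- Enumeration of the left special factors

  -- A sign and a run: `nothing` is the empty run, which has no letter, and `just (b , j)` is a run
  -- of j + 1 letters `b`. Thus different indices give different words, and there are 2 (1 + 2q) of
  -- them.
  Index : Set
  Index = Bool × Maybe (Bool × Fin q)

  bools : List Bool
  bools = false ∷ true ∷ []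

  bools-complete : ∀ b → b ∈ bools
  bools-complete false = here refl
  bools-complete true = there (here refl)

  bools-unique : Unique bools
  bools-unique = ((λ ()) All.∷ All.[]) AllPairs.∷ All.[] AllPairs.∷ AllPairs.[]

  runs : List (Maybe (Bool × Fin q))
  runs = nothing ∷ map just (cartesianProduct bools (allFin q))

  indices : List Index
  indices = cartesianProduct bools runs

  indices-complete : ∀ i → i ∈ indices
  indices-complete (σ , nothing) = ∈-cartesianProduct⁺ (bools-complete σ) (here refl)
  indices-complete (σ , just (b , j)) = ∈-cartesianProduct⁺ (bools-complete σ)
    (there (∈-map⁺ just (∈-cartesianProduct⁺ (bools-complete b) (∈-allFin j))))

  indices-unique : Unique indices
  indices-unique = Unique.cartesianProduct⁺ bools-unique
    (All.map⁺ (All.tabulate (λ _ ())) AllPairs.∷ Unique.map⁺ just-injective (Unique.cartesianProduct⁺ bools-unique (Unique.allFin⁺ q)))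

  length-bools× : ∀ {A : Set} (xs : List A) → length (cartesianProduct bools xs) ≡ length xs + length xs
  length-bools× {A} xs = trans (length-++ (map {B = Bool × A} (false ,_) xs)) (cong₂ _+_ (length-map {B = Bool × A} (false ,_) xs)
    (trans (length-++ (map {B = Bool × A} (true ,_) xs) {[]}) (trans (+-identityʳ _) (length-map {B = Bool × A} (true ,_) xs))))

  length-indices : length indices ≡ 2 + 4 * q
  length-indices = begin
    length indices                                   ≡⟨ length-bools× runs ⟩
    length runs + length runs                        ≡⟨ cong (λ n → suc n + suc n) (trans (length-map just (cartesianProduct bools (allFin q)))
                                                          (trans (length-bools× (allFin q)) (cong (λ n → n + n) (length-tabulate {n = q} (λ i → i))))) ⟩
    suc (q + q) + suc (q + q)                        ≡⟨ doubling ⟩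
    2 + 4 * q                                        ∎
    where
    open ≡-Reasoning
    doubling : suc (q + q) + suc (q + q) ≡ 2 + 4 * q
    doubling = trans (cong suc (+-suc (q + q) (q + q))) (cong (λ n → 2 + n) (trans (+-assoc q q (q + q))
      (cong (λ n → q + (q + (q + n))) (sym (+-identityʳ q)))))

  run : Maybe (Bool × Fin q) → ℕ × Bool
  -- The letter is a dummy, repeated zero times.
  run nothing = 0 , false
  run (just (b , j)) = suc (toℕ j) , b

  runLength : Index → ℕ
  runLength (_ , x) = proj₁ (run x)

  runLength-≤ : ∀ i → runLength i ≤ q
  runLength-≤ (_ , nothing) = z≤n
  runLength-≤ (_ , just (b , j)) = toℕ<n j

  regularWord : ℕ → Index → List Bool
  regularWord n (σ , x) = replicate (proj₁ (run x)) (proj₂ (run x)) ++ σ ⊙ pre (n ∸ proj₁ (run x))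

  exceptionalWord : ℕ → ℕ → Bool → List Bool
  exceptionalWord n m σ = replicate (common m) (sgn σ m) ++ σ ⊙ take (n ∸ common m) (X (suc m) ++ X (m ∸ q ∸ q))

  length-run : ∀ {n} r b σ z → r ≤ n → length z ≡ n ∸ r → length (replicate r b ++ σ ⊙ z) ≡ n
  length-run {n} r b σ z r≤n e = begin
    length (replicate r b ++ σ ⊙ z)            ≡⟨ length-++ (replicate r b) ⟩
    length (replicate r b) + length (σ ⊙ z)    ≡⟨ cong₂ _+_ (length-replicate r) (trans (length-⊙ σ z) e) ⟩
    r + (n ∸ r)                                ≡⟨ m+[n∸m]≡n r≤n ⟩
    n                                          ∎
    where open ≡-Reasoning

  length-run⁻¹ : ∀ {n} r b σ z → length (replicate r b ++ σ ⊙ z) ≡ n → length z ≡ n ∸ r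
  length-run⁻¹ {n} r b σ z refl = sym (trans (cong (_∸ r) (trans (length-++ (replicate r b)) (cong₂ _+_ (length-replicate r) (length-⊙ σ z))))
    (m+n∸m≡n r (length z)))

  -- The different first two letters on the left leave only `zero` for `r`; then the equal second
  -- and third letters would have to be σ′ and its negation.
  run-≢ : ∀ r b σ σ′ {s s′} →
    σ ⊙ (false ∷ true ∷ true ∷ s) ≡ b ∷ replicate r b ++ σ′ ⊙ (false ∷ true ∷ true ∷ s′) → ⊥
  run-≢ zero false false false ()
  run-≢ zero false false true ()
  run-≢ zero false true σ′ ()
  run-≢ zero true false σ′ ()
  run-≢ zero true true false ()
  run-≢ zero true true true ()
  run-≢ (suc r) false false σ′ ()
  run-≢ (suc r) false true σ′ ()
  run-≢ (suc r) true false σ′ ()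
  run-≢ (suc r) true true σ′ ()

  run-injective : ∀ r r′ b b′ σ σ′ {s s′} →
    replicate r b ++ σ ⊙ (false ∷ true ∷ true ∷ s) ≡ replicate r′ b′ ++ σ′ ⊙ (false ∷ true ∷ true ∷ s′) →
    r ≡ r′ × σ ≡ σ′ × (1 ≤ r → b ≡ b′)
  run-injective zero zero b b′ false false e = refl , refl , λ ()
  run-injective zero zero b b′ true true e = refl , refl , λ ()
  run-injective zero zero b b′ false true ()
  run-injective zero zero b b′ true false ()
  run-injective zero (suc r′) b b′ σ σ′ e = ⊥-elim (run-≢ r′ b′ σ σ′ e)
  run-injective (suc r) zero b b′ σ σ′ e = ⊥-elim (run-≢ r b σ′ σ (sym e))
  run-injective (suc r) (suc r′) b b′ σ σ′ e with ∷-injective e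
  ... | refl , e′ with run-injective r r′ b b′ σ σ′ e′
  ... | refl , e″ , _ = refl , e″ , λ _ → refl

  Starts011 : List Bool → Set
  Starts011 z = ∃[ s ] (z ≡ false ∷ true ∷ true ∷ s)

  starts011 : ∀ {z} → X 2 ≼ z → Starts011 z
  starts011 (s , e) = s , trans (sym e) (cong (_++ s) X-2)

  length-X-2 : length (X 2) ≡ 3
  length-X-2 = cong length X-2

  pre-starts : ∀ n → 3 ≤ n → Starts011 (pre n)
  pre-starts n l = starts011 (≼-common (X-mono (≤-trans (s≤s (s≤s z≤n)) l)) (pre-≼ n)
    (≤-trans (≤-reflexive length-X-2) (≤-trans l (≤-reflexive (sym (length-pre n))))))

  starts-injective : ∀ r r′ b b′ σ σ′ {z z′} → Starts011 z → Starts011 z′ →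
    replicate r b ++ σ ⊙ z ≡ replicate r′ b′ ++ σ′ ⊙ z′ → r ≡ r′ × σ ≡ σ′ × (1 ≤ r → b ≡ b′)
  starts-injective r r′ b b′ σ σ′ (s , refl) (s′ , refl) e = run-injective r r′ b b′ σ σ′ e

  regularWord-injective : ∀ {n} → q + 3 ≤ n → ∀ {i j} → regularWord n i ≡ regularWord n j → i ≡ j
  regularWord-injective {n} l {i} {j} e = decode i j (starts-injective _ _ _ _ _ _ (starts i) (starts j) e)
    where
    starts : ∀ i → Starts011 (pre (n ∸ runLength i))
    starts i = pre-starts _ (m+n≤o⇒m≤o∸n 3 (≤-trans (+-monoʳ-≤ 3 (runLength-≤ i)) (≤-trans (≤-reflexive (+-comm 3 q)) l)))
    decode : ∀ i j → runLength i ≡ runLength j × proj₁ i ≡ proj₁ j × (1 ≤ runLength i → proj₂ (run (proj₂ i)) ≡ proj₂ (run (proj₂ j))) → i ≡ j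
    decode (σ , nothing) (σ , nothing) (_ , refl , _) = refl
    decode (σ , just (b , k)) (σ , just (b′ , k′)) (e , refl , eb) with toℕ-injective (suc-injective e) | eb (s≤s z≤n)
    ... | refl | refl = refl

  common-≤ : ∀ m → common m ≤ q
  common-≤ m with len m ≟ suc q
  ... | yes _ = z≤n
  ... | no l≢ = ≤-pred (≤∧≢⇒< (proj₂ (blk-bounds (q + m))) l≢)

  -- The lengths n for which a left special word that does not extend to infinity branches off at level m.
  Exceptional : ℕ → ℕ → Set
  Exceptional n m = q + q ≤ m × length (X (suc m)) + common m < n × n ≤ length (X (suc m)) + length (X (m ∸ q ∸ q)) + common m

  exceptional? : ∀ n m → Dec (Exceptional n m)
  exceptional? n m = (q + q ≤? m) ×-dec (length (X (suc m)) + common m <? n)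
    ×-dec (n ≤? length (X (suc m)) + length (X (m ∸ q ∸ q)) + common m)

  length-X-+ : ∀ d n → d + length (X n) ≤ length (X (d + n))
  length-X-+ zero n = ≤-refl
  length-X-+ (suc d) n = begin
    suc d + length (X n)                          ≡⟨ +-comm 1 (d + length (X n)) ⟩
    d + length (X n) + 1                          ≤⟨ +-mono-≤ (length-X-+ d n) (length-X-pos (d + n ∸ q)) ⟩
    length (X (d + n)) + length (X (d + n ∸ q))   ≡⟨ length-X-suc (d + n) ⟨
    length (X (suc d + n))                        ∎
    where open ≤-Reasoning

  -- Every step lengthens `X` by at least one letter, so |X (m-2q)| + k ≤ |X (m+1-q)|, which absorbs
  -- `common m`. The interval of m therefore ends at or before |X (m+2)|, and that of m′ begins
  -- beyond it. The condition 2q ≤ m makes the subtractions exact.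
  exceptional-< : ∀ {n m m′} → Exceptional n m → Exceptional n m′ → ¬ m < m′
  exceptional-< {n} {m} {m′} (2q≤m , _ , u) (_ , l , _) m<m′ = <-irrefl refl (begin-strict
    n                                                              ≤⟨ u ⟩
    length (X (suc m)) + length (X (m ∸ q ∸ q)) + common m         ≡⟨ +-assoc (length (X (suc m))) _ _ ⟩
    length (X (suc m)) + (length (X (m ∸ q ∸ q)) + common m)       ≤⟨ +-monoʳ-≤ (length (X (suc m))) gap ⟩
    length (X (suc m)) + length (X (suc m ∸ q))                    ≡⟨ length-X-suc (suc m) ⟨
    length (X (suc (suc m)))                                       ≤⟨ length-X-mono (s≤s m<m′) ⟩
    length (X (suc m′))                                            ≤⟨ m≤m+n _ (common m′) ⟩
    length (X (suc m′)) + common m′                                <⟨ l ⟩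
    n                                                              ∎)
    where
    open ≤-Reasoning
    q≤m : q ≤ m
    q≤m = ≤-trans (m≤m+n q q) 2q≤m
    gap : length (X (m ∸ q ∸ q)) + common m ≤ length (X (suc m ∸ q))
    gap = begin
      length (X (m ∸ q ∸ q)) + common m          ≤⟨ +-monoʳ-≤ _ (≤-trans (common-≤ m) (n≤1+n q)) ⟩
      length (X (m ∸ q ∸ q)) + suc q             ≡⟨ +-comm _ (suc q) ⟩
      suc q + length (X (m ∸ q ∸ q))             ≤⟨ length-X-+ (suc q) (m ∸ q ∸ q) ⟩
      length (X (suc (q + (m ∸ q ∸ q))))         ≡⟨ cong (λ j → length (X (suc j))) (m+[n∸m]≡n (m+n≤o⇒m≤o∸n q 2q≤m)) ⟩
      length (X (suc (m ∸ q)))                   ≡⟨ cong (λ j → length (X j)) (+-∸-assoc 1 q≤m) ⟨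
      length (X (suc m ∸ q))                     ∎

  exceptional-unique : ∀ {n m m′} → Exceptional n m → Exceptional n m′ → m ≡ m′
  exceptional-unique {m = m} {m′} e e′ with <-cmp m m′
  ... | tri< l _ _ = contradiction l (exceptional-< e e′)
  ... | tri≈ _ refl _ = refl
  ... | tri> _ _ l = contradiction l (exceptional-< e′ e)

  -- `suc q + 6` serves `left-special`. The last summand excludes the levels m < 2q, where
  -- `X (m ∸ q ∸ q)` is one letter and the word has at most |X (2q)| + 1 + q letters.
  threshold : ℕ
  threshold = suc q + 6 + length (X (q + q))

  threshold-q+3 : q + 3 ≤ threshold
  threshold-q+3 = ≤-trans (+-mono-≤ (n≤1+n q) (s≤s (s≤s (s≤s z≤n)))) (m≤m+n (suc q + 6) _)

  q≤threshold : q ≤ threshold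
  q≤threshold = ≤-trans (m≤m+n q 3) threshold-q+3

  regularWords : ℕ → List (List Bool)
  regularWords n = map (regularWord n) indices

  ∈-regularWords : ∀ {n} r b σ {z j} → r ≤ q → length (replicate r b ++ σ ⊙ z) ≡ n → z ≼ X j →
    replicate r b ++ σ ⊙ z ∈ regularWords n
  ∈-regularWords {n} r b σ {z} r≤q e l = subst (λ v → replicate r b ++ σ ⊙ v ∈ regularWords n)
      (sym (trans (≼X⇒pre l) (cong pre (length-run⁻¹ r b σ z e)))) (go r r≤q)
    where
    go : ∀ r → r ≤ q → replicate r b ++ σ ⊙ pre (n ∸ r) ∈ regularWords n
    go zero _ = ∈-map⁺ (regularWord n) (indices-complete (σ , nothing))
    go (suc r) r<q = subst (λ m → replicate (suc m) b ++ σ ⊙ pre (n ∸ suc m) ∈ regularWords n) (toℕ-fromℕ< r<q)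
      (∈-map⁺ (regularWord n) (indices-complete (σ , just (b , fromℕ< r<q))))

  regularWords-sound : ∀ {n} → q ≤ n → All (λ w → length w ≡ n × (∀ c → InL (c ∷ w))) (regularWords n)
  regularWords-sound {n} q≤n = All.map⁺ {xs = indices} {f = regularWord n} (All.universal (λ (σ , x) →
    length-run (proj₁ (run x)) (proj₂ (run x)) σ (pre (n ∸ proj₁ (run x))) (≤-trans (runLength-≤ (σ , x)) q≤n) (length-pre (n ∸ proj₁ (run x))) ,
    λ c → regular-factor (proj₁ (run x)) (proj₂ (run x)) σ c (runLength-≤ (σ , x)) (pre-≼ (n ∸ proj₁ (run x)))) indices)

  special-listed : ∀ {n w} → threshold ≤ n → length w ≡ n → (∀ c → InL (c ∷ w)) →
    w ∈ regularWords n ⊎ (∃[ m ] ∃[ σ ] (Exceptional n m × w ≡ exceptionalWord n m σ))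
  special-listed {n} {w} t≤n lw i
    with left-special {false} {true} {w} (λ ()) (subst (suc q + 6 ≤_) (sym lw) (≤-trans (m≤m+n _ _) t≤n)) (i false) (i true)
  ... | regular r b σ z j r≤q refl l = inj₁ (∈-regularWords r b σ r≤q lw l)
  ... | exceptional m σ z 1≤m refl l with length z ≤? length (X (suc m))
  -- Here `z` does not reach beyond `X (suc m)`, so the word is already among the regular ones.
  ... | yes z≤ = inj₁ (∈-regularWords (common m) (sgn σ m) σ (common-≤ m) lw (≼-common l (≼-++ (X (suc m))) z≤))
  ... | no z≰ = inj₂ (m , σ , (2q≤m , lower , upper) , cong (λ v → replicate (common m) (sgn σ m) ++ σ ⊙ v)
          (trans (≼-take l) (cong (λ j → take j (X (suc m) ++ X (m ∸ q ∸ q))) lz)))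
    where
    lz : length z ≡ n ∸ common m
    lz = length-run⁻¹ (common m) (sgn σ m) σ z lw
    n≡ : n ≡ length z + common m
    n≡ = sym (trans (cong (_+ common m) lz) (m∸n+n≡m (≤-trans (common-≤ m) (≤-trans q≤threshold t≤n))))
    lower : length (X (suc m)) + common m < n
    lower = subst (length (X (suc m)) + common m <_) (sym n≡) (+-monoˡ-< (common m) (≰⇒> z≰))
    z-upper : length z ≤ length (X (suc m)) + length (X (m ∸ q ∸ q))
    z-upper = ≤-trans (≼-length l) (≤-reflexive (length-++ (X (suc m))))
    upper : n ≤ length (X (suc m)) + length (X (m ∸ q ∸ q)) + common m
    upper = subst (_≤ length (X (suc m)) + length (X (m ∸ q ∸ q)) + common m) (sym n≡) (+-monoˡ-≤ (common m) z-upper)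
    2q≤m : q + q ≤ m
    2q≤m with q + q ≤? m
    ... | yes p = p
    ... | no p = contradiction t≤n (<⇒≱ (begin-strict
        n                                                                  ≤⟨ upper ⟩
        length (X (suc m)) + length (X (m ∸ q ∸ q)) + common m             ≤⟨ +-mono-≤ (+-mono-≤ (length-X-mono (≰⇒> p))
                                                                                (≤-reflexive (trans (cong (λ j → length (X j)) (trans (∸-+-assoc m q q) (m≤n⇒m∸n≡0 (<⇒≤ (≰⇒> p))))) (cong length X-zero))))
                                                                                (common-≤ m) ⟩
        length (X (q + q)) + 1 + q                                         ≡⟨ +-assoc (length (X (q + q))) 1 q ⟩
        length (X (q + q)) + suc q                                         ≡⟨ +-comm _ (suc q) ⟩
        suc q + length (X (q + q))                                         <⟨ +-monoˡ-< (length (X (q + q))) (m<m+n (suc q) (s≤s z≤n)) ⟩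
        threshold                                                          ∎))
      where open ≤-Reasoning

  module _ {n m} (t≤n : threshold ≤ n) (exc : Exceptional n m) where
    private
      Y = X (m ∸ q ∸ q)
      z = take (n ∸ common m) (X (suc m) ++ Y)

      1≤m : 1 ≤ m
      1≤m = ≤-trans 1≤q (≤-trans (m≤m+n q q) (proj₁ exc))

      length-z : length z ≡ n ∸ common m
      length-z = length-take-≤ _ _ (≤-trans (m≤n+o⇒m∸n≤o n (common m) (subst (n ≤_) (+-comm _ (common m)) (proj₂ (proj₂ exc))))
        (≤-reflexive (sym (length-++ (X (suc m))))))

      long-z : length (X (suc m)) < length z
      long-z = subst (length (X (suc m)) <_) (sym length-z) (m+n≤o⇒m≤o∸n (suc (length (X (suc m)))) (proj₁ (proj₂ exc)))

      z-starts : Starts011 z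
      z-starts = starts011 (≼-common (≼-trans (X-mono (s≤s 1≤m)) (≼-++ (X (suc m)))) (take-≼ _ _)
        (≤-trans (length-X-mono (s≤s 1≤m)) (<⇒≤ long-z)))

      -- Being longer than `X (suc m)`, the word `z` continues it with the first letter `false` of
      -- `Y`, whereas a prefix of the limit sequence continues it with `true`.
      z≢pre : ∀ {j} → z ≢ pre j
      z≢pre {j} e with X-head (m ∸ q ∸ q) | X-<-true {suc m} {suc m ⊔ j + 1} (≤-trans (s≤s (m≤m⊔n (suc m) j)) (≤-reflexive (+-comm 1 _)))
      ... | h , eh | t , et = contradiction (≼-∷ʳ (X (suc m)) false-≼ true-≼) (λ ())
        where
        ≼-∷ʳ : ∀ (p : List Bool) {x y v} → p ++ x ∷ [] ≼ v → p ++ y ∷ [] ≼ v → x ≡ y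
        ≼-∷ʳ [] (_ , refl) (_ , e) = sym (proj₁ (∷-injective e))
        ≼-∷ʳ (_ ∷ p) {v = []} (_ , ()) _
        ≼-∷ʳ (_ ∷ p) {v = _ ∷ v} (s , e) (s′ , e′) = ≼-∷ʳ p (s , proj₂ (∷-injective e)) (s′ , proj₂ (∷-injective e′))
        snoc-≤ : ∀ {x} → length (X (suc m) ++ x ∷ []) ≤ length z
        snoc-≤ = ≤-trans (≤-reflexive (trans (length-++ (X (suc m))) (+-comm _ 1))) long-z
        false-≼ : X (suc m) ++ false ∷ [] ≼ z
        false-≼ = ≼-common (h , trans (++-assoc (X (suc m)) _ h) (cong (X (suc m) ++_) (sym eh))) (take-≼ _ _) snoc-≤
        true-≼ : X (suc m) ++ true ∷ [] ≼ z
        true-≼ = ≼-common (t , trans (++-assoc (X (suc m)) _ t) (sym et))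
          (subst (_≼ X (suc m ⊔ j + 1)) (sym e) (≼-trans (pre-≼ j) (X-mono (≤-trans (m≤n⊔m (suc m) j) (m≤m+n _ 1))))) snoc-≤

    exceptionalWords : List (List Bool)
    exceptionalWords = map (exceptionalWord n m) bools

    special-words : LeftSpecials n (regularWords n ++ exceptionalWords)
    special-words = Unique.++⁺ (Unique.map⁺ (regularWord-injective (≤-trans threshold-q+3 t≤n)) indices-unique)
        (Unique.map⁺ {f = exceptionalWord n m} (λ {σ} {σ′} e → proj₁ (proj₂ (starts-injective (common m) (common m) (sgn σ m) (sgn σ′ m) σ σ′ z-starts z-starts e))) bools-unique) disjoint ,
      All.++⁺ (regularWords-sound (≤-trans q≤threshold t≤n)) (All.map⁺ {xs = bools} {f = exceptionalWord n m} (All.universal (λ σ →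
        length-run (common m) (sgn σ m) σ z (≤-trans (common-≤ m) (≤-trans q≤threshold t≤n)) length-z ,
        λ c → exceptional-factor m σ c 1≤m (take-≼ (n ∸ common m) (X (suc m) ++ Y))) bools)) ,
      complete
      where
      disjoint : ∀ {v} → v ∈ regularWords n × v ∈ exceptionalWords → ⊥
      disjoint (p , r) with ∈-map⁻ (regularWord n) {xs = indices} p | ∈-map⁻ (exceptionalWord n m) {xs = bools} r
      ... | (σ , x) , _ , refl | σ′ , _ , e = clash (starts-injective (proj₁ (run x)) (common m) (proj₂ (run x)) (sgn σ′ m) σ σ′
              (pre-starts _ (m+n≤o⇒m≤o∸n 3 (≤-trans (+-monoʳ-≤ 3 (runLength-≤ (σ , x))) (≤-trans (≤-reflexive (+-comm 3 q)) (≤-trans threshold-q+3 t≤n))))) z-starts e) e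
        where
        clash : ∀ {r r′ b b′ σ′} → r ≡ r′ × σ ≡ σ′ × (1 ≤ r → b ≡ b′) → replicate r b ++ σ ⊙ pre (n ∸ proj₁ (run x)) ≡ replicate r′ b′ ++ σ′ ⊙ z → ⊥
        clash {zero} (refl , refl , _) e = z≢pre (sym (⊙-injective σ e))
        clash {suc r} {b = b} (refl , refl , eb) e with eb (s≤s z≤n)
        ... | refl = z≢pre (sym (⊙-injective σ (++-cancelˡ (replicate (suc r) b) _ _ e)))
      complete : ∀ w → length w ≡ n → (∀ c → InL (c ∷ w)) → w ∈ regularWords n ++ exceptionalWords
      complete w l i with special-listed t≤n l i
      ... | inj₁ p = ∈-++⁺ˡ p
      ... | inj₂ (m′ , σ , exc′ , refl) with exceptional-unique exc′ exc
      ... | refl = ∈-++⁺ʳ (regularWords n) (∈-map⁺ (exceptionalWord n m) (bools-complete σ))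

  -- A search below n decides whether an exceptional level m exists, because n > |X (m+1)| > m for
  -- such a level.
  left-specials : ∀ n → threshold ≤ n → ∃[ ls ] (LeftSpecials n ls × (length ls ≡ 2 + 4 * q ⊎ length ls ≡ 4 + 4 * q))
  left-specials n t≤n with anyUpTo? (exceptional? n) n
  ... | yes (m , _ , exc) = _ , special-words t≤n exc , inj₂ (trans (length-++ (regularWords n))
      (trans (cong (_+ 2) (trans (length-map (regularWord n) indices) length-indices)) (+-comm _ 2)))
  ... | no none = regularWords n , (Unique.map⁺ (regularWord-injective (≤-trans threshold-q+3 t≤n)) indices-unique ,
          regularWords-sound (≤-trans q≤threshold t≤n) , complete) ,
        inj₁ (trans (length-map (regularWord n) indices) length-indices)
    where
    complete : ∀ w → length w ≡ n → (∀ c → InL (c ∷ w)) → w ∈ regularWords n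
    complete w l i with special-listed t≤n l i
    ... | inj₁ p = p
    ... | inj₂ (m , σ , exc , _) = contradiction (m , m<n , exc) none
      where
      m<n : m < n
      m<n = ≤-trans (s≤s (≤-trans (n≤1+n m) (<⇒≤ (length-X (suc m))))) (≤-trans (s≤s (m≤m+n _ (common m))) (proj₁ (proj₂ exc)))

  factor-growth : ∀ n → threshold ≤ n → ∃[ ws ] ∃[ vs ] (Factors n ws × Factors (suc n) vs ×
    (length vs ≡ length ws + (2 + 4 * q) ⊎ length vs ≡ length ws + (4 + 4 * q)))
  factor-growth n t≤n with factors n | left-specials n t≤n
  ... | ws , fw | ls , sl , counts with extend n fw sl
  ... | vs , fv , e = ws , vs , fw , fv ,
      map-⊎ (λ l → trans e (cong (length ws +_) l)) (λ l → trans e (cong (length ws +_) l)) counts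

-- The words ξⁿ(0)

nth-++ˡ : ∀ {A : Set} (d : A) u v {i} → i < length u → nth d (u ++ v) i ≡ nth d u i
nth-++ˡ d (x ∷ u) v {zero} l = refl
nth-++ˡ d (x ∷ u) v {suc i} (s≤s l) = nth-++ˡ d u v l

nth-++ʳ : ∀ {A : Set} (d : A) u v j → nth d (u ++ v) (length u + j) ≡ nth d v j
nth-++ʳ d [] v j = refl
nth-++ʳ d (x ∷ u) v j = nth-++ʳ d u v j

nth-map : ∀ {A B : Set} (f : A → B) d v i → f (nth d v i) ≡ nth (f d) (map f v) i
nth-map f d [] i = refl
nth-map f d (x ∷ v) zero = refl
nth-map f d (x ∷ v) (suc i) = nth-map f d v i

applyUpTo-nth : ∀ {A : Set} (d : A) (f : ℕ → A) w → (∀ j → j < length w → f j ≡ nth d w j) → applyUpTo f (length w) ≡ w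
applyUpTo-nth d f [] h = refl
applyUpTo-nth d f (x ∷ w) h = cong₂ _∷_ (h 0 (s≤s z≤n)) (applyUpTo-nth d (λ j → f (suc j)) w (λ j l → h (suc j) (s≤s l)))

module Morphism (q : ℕ) (1≤q : 1 ≤ q) where

  private
    k = suc q

  iter : ℕ → List (Letter k) → List (Letter k)
  iter zero v = v
  iter (suc n) v = ξ* (iter n v)

  iter-ξ* : ∀ n v → iter n (ξ* v) ≡ ξ* (iter n v)
  iter-ξ* zero v = refl
  iter-ξ* (suc n) v = cong ξ* (iter-ξ* n v)

  iter-+ : ∀ m n v → iter (m + n) v ≡ iter m (iter n v)
  iter-+ zero n v = refl
  iter-+ (suc m) n v = cong ξ* (iter-+ m n v)

  iter-++ : ∀ n u v → iter n (u ++ v) ≡ iter n u ++ iter n v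
  iter-++ zero u v = refl
  iter-++ (suc n) u v = trans (cong ξ* (iter-++ n u v)) (concatMap-++ ξ (iter n u) (iter n v))

  origin : Letter k
  origin = zero , false

  letters : ℕ → List (Letter k)
  letters n = ξ^ n [0]

  ξ^-iter : ∀ n → letters n ≡ iter n (origin ∷ [])
  ξ^-iter zero = refl
  ξ^-iter (suc n) = cong ξ* (ξ^-iter n)

  next-inner : ∀ (i : Fin k) p → toℕ i < q → ∃[ i′ ] (toℕ i′ ≡ suc (toℕ i) × next (i , p) ≡ (i′ , p))
  next-inner i p l with suc (toℕ i) <? k
  ... | yes lt = fromℕ< lt , toℕ-fromℕ< lt , refl
  ... | no ¬lt = contradiction (s≤s l) ¬lt

  next-last : ∀ (i : Fin k) p → toℕ i ≡ q → next (i , p) ≡ (zero , not p)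
  next-last i p e with suc (toℕ i) <? k
  ... | yes lt = contradiction (cong suc e) (<⇒≢ lt)
  ... | no _ = refl

  iter-wrap-suc : ∀ m (i : Fin k) p → 1 ≤ toℕ i → toℕ i + m ≡ q → iter (suc m) ((i , p) ∷ []) ≡ (zero , not p) ∷ []
  iter-wrap-suc zero (suc j) p _ e = cong (_∷ []) (next-last (suc j) p (trans (sym (+-identityʳ _)) e))
  iter-wrap-suc (suc m) (suc j) p _ e with next-inner (suc j) p
    (≤-trans (m≤m+n (2 + toℕ j) m) (≤-reflexive (trans (sym (+-suc (suc (toℕ j)) m)) e)))
  ... | i′ , ei , en = trans (sym (iter-ξ* (suc m) _)) (trans (cong (λ a → iter (suc m) (a ∷ [])) en)
      (iter-wrap-suc m i′ p (≤-trans (s≤s z≤n) (≤-reflexive (sym ei))) (trans (cong (_+ m) ei) (trans (sym (+-suc (suc (toℕ j)) m)) e))))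

  iter-wrap : ∀ m (i : Fin k) p → 1 ≤ toℕ i → toℕ i + m ≡ k → iter m ((i , p) ∷ []) ≡ (zero , not p) ∷ []
  iter-wrap zero i p _ e = contradiction (trans (sym (+-identityʳ _)) e) (<⇒≢ (toℕ<n i))
  iter-wrap (suc m) i p l e = iter-wrap-suc m i p l (suc-injective (trans (sym (+-suc (toℕ i) m)) e))

  iter-inner : ∀ m (i : Fin k) p → 1 ≤ toℕ i → toℕ i + m < k → ∃[ i′ ] (1 ≤ toℕ i′ × iter m ((i , p) ∷ []) ≡ (i′ , p) ∷ [])
  iter-inner zero i p 1≤i l = i , 1≤i , refl
  iter-inner (suc m) (suc j) p 1≤i l with next-inner (suc j) p (≤-pred (≤-trans (s≤s (≤-trans (m≤m+n (2 + toℕ j) m) (≤-reflexive (sym (+-suc (suc (toℕ j)) m))))) l))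
  ... | i′ , ei , en with iter-inner m i′ p (≤-trans (s≤s z≤n) (≤-reflexive (sym ei))) (subst (_< k) (trans (+-suc (suc (toℕ j)) m) (cong (_+ m) (sym ei))) l)
  ... | i″ , 1≤i″ , e = i″ , 1≤i″ , trans (sym (iter-ξ* m _)) (trans (cong (λ a → iter m (a ∷ [])) en) e)

  flipLetter : Letter k → Letter k
  flipLetter (j , p) = j , not p

  next-flip : ∀ a → next (flipLetter a) ≡ flipLetter (next a)
  next-flip (j , p) with suc (toℕ j) <? k
  ... | yes _ = refl
  ... | no _ = refl

  ξ-flip : ∀ a → ξ (flipLetter a) ≡ map flipLetter (ξ a)
  ξ-flip (zero , p) = cong (λ a → (zero , not p) ∷ a ∷ []) (next-flip (zero , p))
  ξ-flip (suc j , p) = cong (_∷ []) (next-flip (suc j , p))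

  ξ*-flip : ∀ v → ξ* (map flipLetter v) ≡ map flipLetter (ξ* v)
  ξ*-flip [] = refl
  ξ*-flip (a ∷ v) = trans (cong₂ _++_ (ξ-flip a) (ξ*-flip v)) (sym (map-++ flipLetter (ξ a) (ξ* v)))

  iter-flip : ∀ n v → iter n (map flipLetter v) ≡ map flipLetter (iter n v)
  iter-flip zero v = refl
  iter-flip (suc n) v = trans (cong ξ* (iter-flip n v)) (ξ*-flip (iter n v))

  π-flip : ∀ a → π (flipLetter a) ≡ not (π a)
  π-flip (zero , p) = refl
  π-flip (suc j , p) = refl

  X : ℕ → List Bool
  X n = map π (letters n)

  -- The letter 1 becomes 0′ after q steps, and from then on its images are those of 0 with primes
  -- exchanged, which `π` turns into negation. Before that it is a single letter projected to
  -- `true`, that is `true ⊙ X 0`; truncated subtraction unites the two cases.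
  second-half : ∀ n → map π (iter n (next origin ∷ [])) ≡ true ⊙ X (n ∸ q)
  second-half n with next-inner zero false 1≤q | n <? q
  ... | i , ei , en | yes n<q with iter-inner n i false (≤-reflexive (sym ei)) (subst (λ m → m + n < k) (sym ei) (s≤s n<q))
  ... | suc i′ , _ , e = trans (cong (λ a → map π (iter n (a ∷ []))) en) (trans (cong (map π) e)
      (cong (λ m → true ⊙ X m) (sym (m≤n⇒m∸n≡0 (<⇒≤ n<q)))))
  second-half n | i , ei , en | no n≮q = begin
      map π (iter n (next origin ∷ []))                          ≡⟨ cong (λ a → map π (iter n (a ∷ []))) en ⟩
      map π (iter n ((i , false) ∷ []))                          ≡⟨ cong (λ m → map π (iter m ((i , false) ∷ []))) (m∸n+n≡m (≮⇒≥ n≮q)) ⟨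
      map π (iter (n ∸ q + q) ((i , false) ∷ []))                ≡⟨ cong (map π) (iter-+ (n ∸ q) q _) ⟩
      map π (iter (n ∸ q) (iter q ((i , false) ∷ [])))           ≡⟨ cong (λ v → map π (iter (n ∸ q) v))
                                                                    (iter-wrap q i false (≤-reflexive (sym ei)) (cong (_+ q) ei)) ⟩
      map π (iter (n ∸ q) (map flipLetter (origin ∷ [])))        ≡⟨ cong (map π) (iter-flip (n ∸ q) (origin ∷ [])) ⟩
      map π (map flipLetter (iter (n ∸ q) (origin ∷ [])))        ≡⟨ cong (λ v → map π (map flipLetter v)) (ξ^-iter (n ∸ q)) ⟨
      map π (map flipLetter (letters (n ∸ q)))                    ≡⟨ map-∘ (letters (n ∸ q)) ⟨
      map (λ a → π (flipLetter a)) (letters (n ∸ q))              ≡⟨ map-cong π-flip (letters (n ∸ q)) ⟩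
      map (λ a → not (π a)) (letters (n ∸ q))                     ≡⟨ map-∘ (letters (n ∸ q)) ⟩
      true ⊙ X (n ∸ q)                                           ∎
    where open ≡-Reasoning

  X-suc : ∀ n → X (suc n) ≡ X n ++ true ⊙ X (n ∸ q)
  X-suc n = begin
    map π (ξ* (letters n))                                          ≡⟨ cong (λ v → map π (ξ* v)) (ξ^-iter n) ⟩
    map π (ξ* (iter n (origin ∷ [])))                              ≡⟨ cong (map π) (iter-ξ* n (origin ∷ [])) ⟨
    map π (iter n (origin ∷ next origin ∷ []))                     ≡⟨ cong (map π) (iter-++ n (origin ∷ []) _) ⟩
    map π (iter n (origin ∷ []) ++ iter n (next origin ∷ []))      ≡⟨ map-++ π (iter n (origin ∷ [])) _ ⟩
    map π (iter n (origin ∷ [])) ++ map π (iter n (next origin ∷ []))  ≡⟨ cong₂ _++_ (cong (map π) (sym (ξ^-iter n))) (second-half n) ⟩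
    X n ++ true ⊙ X (n ∸ q)                                        ∎
    where open ≡-Reasoning

  open Words q 1≤q X refl X-suc

  -- Factors of the sequence as infixes of the words `X n`

  𝐱-nth : ∀ n i → i < length (X n) → 𝐱 k i ≡ nth false (X n) i
  𝐱-nth n i l with X-mono (m≤m⊔n n (suc i)) | X-mono (m≤n⊔m n (suc i))
  ... | s , e | t , e′ = begin
    π (nth origin (letters (suc i)) i)      ≡⟨ nth-map π origin (letters (suc i)) i ⟩
    nth false (X (suc i)) i              ≡⟨ nth-++ˡ false (X (suc i)) t (<⇒≤ (length-X (suc i))) ⟨
    nth false (X (suc i) ++ t) i         ≡⟨ cong (λ v → nth false v i) (trans e′ (sym e)) ⟩
    nth false (X n ++ s) i               ≡⟨ nth-++ˡ false (X n) s l ⟩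
    nth false (X n) i                    ∎
    where open ≡-Reasoning

  window-infix : ∀ {n} a w b → a ++ w ++ b ≡ X n → window (𝐱 k) (length a) (length w) ≡ w
  window-infix {n} a w b e = trans (map-upTo _ (length w)) (applyUpTo-nth false _ w (λ j l → begin
    𝐱 k (length a + j)                           ≡⟨ 𝐱-nth n (length a + j) (inside l) ⟩
    nth false (X n) (length a + j)               ≡⟨ cong (λ v → nth false v (length a + j)) e ⟨
    nth false (a ++ w ++ b) (length a + j)       ≡⟨ nth-++ʳ false a (w ++ b) j ⟩
    nth false (w ++ b) j                         ≡⟨ nth-++ˡ false w b l ⟩
    nth false w j                                ∎))
    where
    open ≡-Reasoning
    inside : ∀ {j} → j < length w → length a + j < length (X n)
    inside l = ≤-trans (+-monoʳ-< (length a) (≤-trans l (≤-trans (m≤m+n _ (length b)) (≤-reflexive (sym (length-++ w))))))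
      (≤-reflexive (trans (sym (length-++ a)) (cong length e)))

  InL⇒IsFactor : ∀ {w} → InL w → IsFactor (𝐱 k) w
  InL⇒IsFactor {w} (n , a , b , e) = length a , window-infix {n} a w b e

  IsFactor⇒InL : ∀ {w} → IsFactor (𝐱 k) w → InL w
  IsFactor⇒InL {w} (i , e) = n , subst (λ v → Infix v (X n)) v≡w (a , b , split)
    where
    n = i + length w
    a = take i (X n)
    v = take (length w) (drop i (X n))
    b = drop (length w) (drop i (X n))
    split : a ++ v ++ b ≡ X n
    split = trans (cong (a ++_) (take++drop≡id (length w) (drop i (X n)))) (take++drop≡id i (X n))
    length-a : length a ≡ i
    length-a = length-take-≤ i (X n) (≤-trans (m≤m+n i (length w)) (<⇒≤ (length-X n)))
    length-v : length v ≡ length w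
    length-v = length-take-≤ (length w) (drop i (X n)) (≤-trans
      (m+n≤o⇒m≤o∸n (length w) (≤-trans (≤-reflexive (+-comm (length w) i)) (<⇒≤ (length-X n)))) (≤-reflexive (sym (length-drop i (X n)))))
    v≡w : v ≡ w
    v≡w = trans (sym (window-infix {n} a v b split)) (trans (cong₂ (window (𝐱 k)) length-a length-v) e)

  complexity : ∀ {n ws} → Factors n ws → Complexity (𝐱 k) n (length ws)
  complexity {ws = ws} (unique , sound , complete) = ws , refl , unique ,
    All.map (λ (l , i) → l , InL⇒IsFactor i) sound , λ w l f → complete w l (IsFactor⇒InL f)

  Growth : ℕ → Set
  Growth n = ∃[ a ] ∃[ b ] (Complexity (𝐱 k) n a × Complexity (𝐱 k) (suc n) b × (b ≡ a + (4 * k ∸ 2) ⊎ b ≡ a + 4 * k))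

  growth : ∀ n → threshold ≤ n → Growth n
  growth n t≤n = conclude (factor-growth n t≤n)
    where
    conclude : ∃[ ws ] ∃[ vs ] (Factors n ws × Factors (suc n) vs ×
      (length vs ≡ length ws + (2 + 4 * q) ⊎ length vs ≡ length ws + (4 + 4 * q))) → Growth n
    conclude (ws , vs , fw , fv , counts) = length ws , length vs , complexity fw , complexity fv ,
      -- With `4 * k` in the form `4 + 4 * q`, subtracting 2 computes to `2 + 4 * q`.
      subst (λ c → length vs ≡ length ws + (c ∸ 2) ⊎ length vs ≡ length ws + c) (sym (*-suc 4 q)) counts

  eventual-growth : ∃[ n₀ ] (∀ n → n₀ ≤ n → Growth n)
  eventual-growth = threshold , growth

theorem3 : ∀ (k : ℕ) → 4 ≤ k →
    ∃[ N₀ ] (∀ N → N₀ ≤ N →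
    ∃[ a ] ∃[ b ] (Complexity (𝐱 k) N a × Complexity (𝐱 k) (suc N) b ×
    (b ≡ a + (4 * k ∸ 2) ⊎ b ≡ a + 4 * k)))
theorem3 (suc q) (s≤s 3≤q) = Morphism.eventual-growth q (≤-trans (s≤s z≤n) 3≤q)
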